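{- Let $\zeta\in\mathbb{C}$ be a primitive sixth root of unity. Let $r/s>1$ be an irreducible fraction with Hirzebruch--Jung continued fraction $r/s=[\![c_1,\dots,c_k]\!]$, and put $C_0=0$ and $C_i=c_1+\dots+c_i$ for $1\le i\le k$. Then \[ \mathcal{R}_{r/s}(\zeta)=\zeta^{C_k-2k}\sum_{i=0}^{k}(-1)^i\zeta^{ -C_i} \quad\text{and}\quad \mathcal{S}_{r/s}(\zeta)=\zeta^{C_k-2k-1}\sum_{i=1}^{k}(-1)^i\zeta^{ -C_i}. \]
   Context: Every irreducible fraction $r/s>1$ has a unique Hirzebruch--Jung expansion $r/s=[\![c_1,\dots,c_k]\!]=c_1-\cfrac{1}{c_2-\cfrac{1}{\ddots-\cfrac{1}{c_k}}}$ with all $c_i\ge 2$ integers. Put $R_q=\begin{pmatrix}q&1\\0&1\end{pmatrix}$, $S_q=\begin{pmatrix}0&-q^{ -1}\\1&0\end{pmatrix}$ and $M_q(c_1,\dots,c_k)=R_q^{c_1}S_q\cdots R_q^{c_k}S_q$. For $r/s=[\![c_1,\dots,c_k]\!]>1$, the numerator $\mathcal{R}_{r/s}(q)\in\mathbb{Z}[q]$ and denominator $\mathcal{S}_{r/s}(q)\in\mathbb{Z}[q]$ of the $q$-deformed rational number $[r/s]_q=\mathcal{R}_{r/s}(q)/\mathcal{S}_{r/s}(q)$ are defined as the upper and lower entries, respectively, of the first column of $M_q(c_1,\dots,c_k)$. -}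

module Defs where

open import Algebra.Bundles using (CommutativeRing)
open import Data.Integer.Base as ℤ using (ℤ; +_; -[1+_]; 0ℤ; 1ℤ; -1ℤ)
import Data.Integer.Properties as ℤₚ
open import Data.List.Base using (List; []; _∷_; map; take)
open import Data.Nat.ListAction using (sum)
open import Data.Nat.Base as ℕ using (ℕ; zero; suc; s≤s; z≤n; NonZero)
import Data.Nat.Properties as ℕₚ
open import Data.Product.Base using (∃; _×_; _,_; proj₁; proj₂)
open import Data.Rational.Base as ℚ using (ℚ; 0ℚ; 1ℚ; ½; ∣_∣; Positive; 1/_)
open import Data.Rational.Literals using (fromℤ)
import Data.Rational.Base as Rational
import Data.Rational.Properties as ℚₚ
import Data.Rational.Solver as ℚ-Solver
open import Data.Vec.Base using (Vec; []; _∷_; toList)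
open import Data.Vec.Relation.Unary.All using (All; []; _∷_)
open import Level using (0ℓ; _⊔_)
open import Relation.Binary.PropositionalEquality
open import Relation.Nullary.Negation.Core using (¬_)

-- ℝ is the set of Cauchy sequences of rationals, with equality _≈ʳ_ up to
-- null sequences and termwise operations.

module _ where
  open Rational using (_+_; _*_; _-_; -_; _<_; _≤_)

  IsCauchy : (ℕ → ℚ) → Set
  IsCauchy x = ∀ ε → 0ℚ < ε →
    ∃ λ N → ∀ m n → N ℕ.≤ m → N ℕ.≤ n → ∣ x m - x n ∣ < ε

  record ℝ : Set where
    constructor mkℝ
    field
      seq    : ℕ → ℚ
      cauchy : IsCauchy seq

  open ℝ public

  infix 4 _≈ʳ_

  _≈ʳ_ : ℝ → ℝ → Set
  x ≈ʳ y = ∀ ε → 0ℚ < ε →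
    ∃ λ N → ∀ n → N ℕ.≤ n → ∣ seq x n - seq y n ∣ < ε

  private
    0<½* : ∀ ε → 0ℚ < ε → 0ℚ < ½ * ε
    0<½* ε 0<ε = ℚₚ.positive⁻¹ (½ * ε) {{ℚₚ.pos*pos⇒pos ½ ε {{ℚ.positive 0<ε}}}}

    halves : ∀ ε → ½ * ε + ½ * ε ≡ ε
    halves ε = trans (sym (ℚₚ.*-distribʳ-+ ε ½ ½)) (ℚₚ.*-identityˡ ε)

    split : ∀ ε z a b → z ≡ a + b → ∣ a ∣ < ½ * ε → ∣ b ∣ < ½ * ε → ∣ z ∣ < ε
    split ε z a b z≡ a< b< = begin-strict
      ∣ z ∣             ≡⟨ cong ∣_∣ z≡ ⟩
      ∣ a + b ∣         ≤⟨ ℚₚ.∣p+q∣≤∣p∣+∣q∣ a b ⟩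
      ∣ a ∣ + ∣ b ∣     <⟨ ℚₚ.+-mono-< a< b< ⟩
      ½ * ε + ½ * ε     ≡⟨ halves ε ⟩
      ε                 ∎
      where open ℚₚ.≤-Reasoning

    _/₊_ : (p q : ℚ) .{{_ : Positive q}} → ℚ
    p /₊ q = p * (1/ q) {{ℚₚ.pos⇒nonZero q}}

    *-/₊ : ∀ p q .{{_ : Positive q}} → q * (p /₊ q) ≡ p
    *-/₊ p q = begin
      q * (p * q⁻¹)   ≡⟨ cong (q *_) (ℚₚ.*-comm p q⁻¹) ⟩
      q * (q⁻¹ * p)   ≡⟨ ℚₚ.*-assoc q q⁻¹ p ⟨
      q * q⁻¹ * p     ≡⟨ cong (_* p) (ℚₚ.*-inverseʳ q {{ℚₚ.pos⇒nonZero q}}) ⟩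
      1ℚ * p          ≡⟨ ℚₚ.*-identityˡ p ⟩
      p               ∎
      where
      open ≡-Reasoning
      q⁻¹ = (1/ q) {{ℚₚ.pos⇒nonZero q}}

    0</₊ : ∀ p q .{{_ : Positive q}} → 0ℚ < p → 0ℚ < p /₊ q
    0</₊ p q 0<p = ℚₚ.positive⁻¹ _
      {{ℚₚ.pos*pos⇒pos p {{ℚ.positive 0<p}} _ {{ℚₚ.1/pos⇒pos q}}}}

    ∣*∣< : ∀ a b δ B .{{_ : Positive B}} → ∣ a ∣ < B → ∣ b ∣ < δ /₊ B → ∣ a * b ∣ < δ
    ∣*∣< a b δ B a< b< = begin-strict
      ∣ a * b ∣          ≡⟨ ℚₚ.∣p*q∣≡∣p∣*∣q∣ a b ⟩
      ∣ a ∣ * ∣ b ∣      ≤⟨ ℚₚ.*-monoʳ-≤-nonNeg ∣ b ∣ {{ℚₚ.∣-∣-nonNeg b}} (ℚₚ.<⇒≤ a<) ⟩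
      B * ∣ b ∣          <⟨ ℚₚ.*-monoʳ-<-pos B b< ⟩
      B * (δ /₊ B)       ≡⟨ *-/₊ δ B ⟩
      δ                  ∎
      where open ℚₚ.≤-Reasoning

    +-interchange-- : ∀ a b c d → (a + b) - (c + d) ≡ (a - c) + (b - d)
    +-interchange-- = solve 4 (λ a b c d → (a :+ b) :- (c :+ d) := (a :- c) :+ (b :- d)) refl
      where open ℚ-Solver.+-*-Solver

    telescope : ∀ a b c → a - c ≡ (a - b) + (b - c)
    telescope = solve 3 (λ a b c → a :- c := (a :- b) :+ (b :- c)) refl
      where open ℚ-Solver.+-*-Solver

    neg-sub : ∀ a b → - (a - b) ≡ (- a) - (- b)
    neg-sub = solve 2 (λ a b → :- (a :- b) := (:- a) :- (:- b)) refl
      where open ℚ-Solver.+-*-Solver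

    sub-swap : ∀ a b → - (a - b) ≡ b - a
    sub-swap = solve 2 (λ a b → :- (a :- b) := b :- a) refl
      where open ℚ-Solver.+-*-Solver

    product-close : ∀ ε a b c d A D .{{_ : Positive A}} .{{_ : Positive D}} →
      ∣ a ∣ < A → ∣ d ∣ < D →
      ∣ a - c ∣ < (½ * ε) /₊ D → ∣ b - d ∣ < (½ * ε) /₊ A →
      ∣ a * b - c * d ∣ < ε
    product-close ε a b c d A D a< d< ac< bd< =
      split ε _ (a * (b - d)) (d * (a - c))
        (solve 4 (λ a b c d → a :* b :- c :* d := a :* (b :- d) :+ d :* (a :- c)) refl a b c d)
        (∣*∣< a (b - d) (½ * ε) A a< bd<) (∣*∣< d (a - c) (½ * ε) D d< ac<)
      where open ℚ-Solver.+-*-Solver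

    eventually-bounded : ∀ x → IsCauchy x →
      ∃ λ B → Positive B × ∃ λ N → ∀ n → N ℕ.≤ n → ∣ x n ∣ < B
    eventually-bounded x cx with cx 1ℚ (ℚₚ.positive⁻¹ 1ℚ)
    ... | N , close = 1ℚ + ∣ x N ∣
        , ℚₚ.pos+nonNeg⇒pos 1ℚ ∣ x N ∣ {{ℚₚ.∣-∣-nonNeg (x N)}}
        , N , bound
      where
      bound : ∀ n → N ℕ.≤ n → ∣ x n ∣ < 1ℚ + ∣ x N ∣
      bound n N≤n = begin-strict
        ∣ x n ∣                   ≡⟨ cong ∣_∣ (solve 2 (λ a b → a := (a :- b) :+ b) refl (x n) (x N)) ⟩
        ∣ (x n - x N) + x N ∣     ≤⟨ ℚₚ.∣p+q∣≤∣p∣+∣q∣ (x n - x N) (x N) ⟩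
        ∣ x n - x N ∣ + ∣ x N ∣   <⟨ ℚₚ.+-monoˡ-< ∣ x N ∣ (close n N N≤n ℕₚ.≤-refl) ⟩
        1ℚ + ∣ x N ∣              ∎
        where
        open ℚₚ.≤-Reasoning
        open ℚ-Solver.+-*-Solver

    ∣0∣< : ∀ {ε z} → 0ℚ < ε → z ≡ 0ℚ → ∣ z ∣ < ε
    ∣0∣< 0<ε refl = 0<ε

    ⊔ˡ : ∀ {m n o} → m ℕ.⊔ n ℕ.≤ o → m ℕ.≤ o
    ⊔ˡ {m} {n} = ℕₚ.≤-trans (ℕₚ.m≤m⊔n m n)

    ⊔ʳ : ∀ {m n o} → m ℕ.⊔ n ℕ.≤ o → n ℕ.≤ o
    ⊔ʳ {m} {n} = ℕₚ.≤-trans (ℕₚ.m≤n⊔m m n)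

  constʳ : ℚ → ℝ
  constʳ p = mkℝ (λ _ → p) λ ε 0<ε → 0 , λ _ _ _ _ → ∣0∣< 0<ε (ℚₚ.+-inverseʳ p)

  infixl 6 _+ʳ_
  infixl 7 _*ʳ_
  infix  8 -ʳ_

  _+ʳ_ : ℝ → ℝ → ℝ
  x +ʳ y = mkℝ (λ n → seq x n + seq y n) λ ε 0<ε →
    let (N₁ , p₁) = cauchy x (½ * ε) (0<½* ε 0<ε)
        (N₂ , p₂) = cauchy y (½ * ε) (0<½* ε 0<ε)
    in N₁ ℕ.⊔ N₂ , λ m n N≤m N≤n →
      split ε _ (seq x m - seq x n) (seq y m - seq y n)
        (+-interchange-- (seq x m) (seq y m) (seq x n) (seq y n))
        (p₁ m n (⊔ˡ N≤m) (⊔ˡ N≤n)) (p₂ m n (⊔ʳ {N₁} N≤m) (⊔ʳ {N₁} N≤n))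
    where open ℚ-Solver.+-*-Solver

  private
    neg-close : ∀ {ε} a b → ∣ a - b ∣ < ε → ∣ (- a) - (- b) ∣ < ε
    neg-close {ε} a b = subst (_< ε) (trans (sym (ℚₚ.∣-p∣≡∣p∣ (a - b)))
      (cong ∣_∣ (neg-sub a b)))
      where open ℚ-Solver.+-*-Solver

  -ʳ_ : ℝ → ℝ
  -ʳ x = mkℝ (λ n → - seq x n) λ ε 0<ε →
    let (N , p) = cauchy x ε 0<ε
    in N , λ m n N≤m N≤n → neg-close (seq x m) (seq x n) (p m n N≤m N≤n)

  _*ʳ_ : ℝ → ℝ → ℝ
  x *ʳ y = mkℝ (λ n → seq x n * seq y n) product-cauchy
    where
    product-cauchy : IsCauchy (λ n → seq x n * seq y n)
    product-cauchy ε 0<ε =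
      let (A , A>0 , N₁ , x<A) = eventually-bounded (seq x) (cauchy x)
          (D , D>0 , N₂ , y<D) = eventually-bounded (seq y) (cauchy y)
          (N₃ , p) = cauchy x (((½ * ε) /₊ D) {{D>0}}) (0</₊ (½ * ε) D {{D>0}} (0<½* ε 0<ε))
          (N₄ , q) = cauchy y (((½ * ε) /₊ A) {{A>0}}) (0</₊ (½ * ε) A {{A>0}} (0<½* ε 0<ε))
      in (N₁ ℕ.⊔ N₂) ℕ.⊔ (N₃ ℕ.⊔ N₄) , λ m n N≤m N≤n →
        product-close ε (seq x m) (seq y m) (seq x n) (seq y n) A D {{A>0}} {{D>0}}
          (x<A m (⊔ˡ (⊔ˡ N≤m))) (y<D n (⊔ʳ {N₁} (⊔ˡ N≤n)))
          (p m n (⊔ˡ (⊔ʳ {N₁ ℕ.⊔ N₂} N≤m)) (⊔ˡ (⊔ʳ {N₁ ℕ.⊔ N₂} N≤n)))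
          (q m n (⊔ʳ {N₃} (⊔ʳ {N₁ ℕ.⊔ N₂} N≤m)) (⊔ʳ {N₃} (⊔ʳ {N₁ ℕ.⊔ N₂} N≤n)))

  pointwise⇒≈ʳ : ∀ x y → (∀ n → seq x n ≡ seq y n) → x ≈ʳ y
  pointwise⇒≈ʳ x y eq ε 0<ε = 0 , λ n _ →
    ∣0∣< 0<ε (trans (cong (_- seq y n) (eq n)) (ℚₚ.+-inverseʳ (seq y n)))

  ≈ʳ-refl : ∀ {x} → x ≈ʳ x
  ≈ʳ-refl {x} = pointwise⇒≈ʳ x x λ _ → refl

  ≈ʳ-sym : ∀ {x y} → x ≈ʳ y → y ≈ʳ x
  ≈ʳ-sym {x} {y} x≈y ε 0<ε =
    let (N , p) = x≈y ε 0<ε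
    in N , λ n N≤n → subst (_< ε) (trans (sym (ℚₚ.∣-p∣≡∣p∣ (seq x n - seq y n)))
         (cong ∣_∣ (sub-swap (seq x n) (seq y n))))
         (p n N≤n)
    where open ℚ-Solver.+-*-Solver

  ≈ʳ-trans : ∀ {x y z} → x ≈ʳ y → y ≈ʳ z → x ≈ʳ z
  ≈ʳ-trans {x} {y} {z} x≈y y≈z ε 0<ε =
    let (N₁ , p₁) = x≈y (½ * ε) (0<½* ε 0<ε)
        (N₂ , p₂) = y≈z (½ * ε) (0<½* ε 0<ε)
    in N₁ ℕ.⊔ N₂ , λ n N≤n →
      split ε _ (seq x n - seq y n) (seq y n - seq z n)
        (telescope (seq x n) (seq y n) (seq z n))
        (p₁ n (⊔ˡ N≤n)) (p₂ n (⊔ʳ {N₁} N≤n))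
    where open ℚ-Solver.+-*-Solver

  +ʳ-cong : ∀ {x x′ y y′} → x ≈ʳ x′ → y ≈ʳ y′ → x +ʳ y ≈ʳ x′ +ʳ y′
  +ʳ-cong {x} {x′} {y} {y′} x≈ y≈ ε 0<ε =
    let (N₁ , p₁) = x≈ (½ * ε) (0<½* ε 0<ε)
        (N₂ , p₂) = y≈ (½ * ε) (0<½* ε 0<ε)
    in N₁ ℕ.⊔ N₂ , λ n N≤n →
      split ε _ (seq x n - seq x′ n) (seq y n - seq y′ n)
        (+-interchange-- (seq x n) (seq y n) (seq x′ n) (seq y′ n))
        (p₁ n (⊔ˡ N≤n)) (p₂ n (⊔ʳ {N₁} N≤n))
    where open ℚ-Solver.+-*-Solver

  -ʳ-cong : ∀ {x y} → x ≈ʳ y → -ʳ x ≈ʳ -ʳ y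
  -ʳ-cong {x} {y} x≈y ε 0<ε =
    let (N , p) = x≈y ε 0<ε
    in N , λ n N≤n → neg-close (seq x n) (seq y n) (p n N≤n)

  *ʳ-cong : ∀ {x x′ y y′} → x ≈ʳ x′ → y ≈ʳ y′ → x *ʳ y ≈ʳ x′ *ʳ y′
  *ʳ-cong {x} {x′} {y} {y′} x≈ y≈ ε 0<ε =
    let (A , A>0 , N₁ , x<A) = eventually-bounded (seq x) (cauchy x)
        (D , D>0 , N₂ , y<D) = eventually-bounded (seq y′) (cauchy y′)
        (N₃ , p) = x≈ (((½ * ε) /₊ D) {{D>0}}) (0</₊ (½ * ε) D {{D>0}} (0<½* ε 0<ε))
        (N₄ , q) = y≈ (((½ * ε) /₊ A) {{A>0}}) (0</₊ (½ * ε) A {{A>0}} (0<½* ε 0<ε))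
    in (N₁ ℕ.⊔ N₂) ℕ.⊔ (N₃ ℕ.⊔ N₄) , λ n N≤n →
      product-close ε (seq x n) (seq y n) (seq x′ n) (seq y′ n) A D {{A>0}} {{D>0}}
        (x<A n (⊔ˡ (⊔ˡ N≤n))) (y<D n (⊔ʳ {N₁} (⊔ˡ N≤n)))
        (p n (⊔ˡ (⊔ʳ {N₁ ℕ.⊔ N₂} N≤n))) (q n (⊔ʳ {N₃} (⊔ʳ {N₁ ℕ.⊔ N₂} N≤n)))

infix 4 _≈ᶜ_

record ℂ : Set where
  constructor _+i_
  field
    re im : ℝ

open ℂ public

_≈ᶜ_ : ℂ → ℂ → Set
z ≈ᶜ w = re z ≈ʳ re w × im z ≈ʳ im w

_+ᶜ_ : ℂ → ℂ → ℂ
z +ᶜ w = (re z +ʳ re w) +i (im z +ʳ im w)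

_*ᶜ_ : ℂ → ℂ → ℂ
z *ᶜ w = (re z *ʳ re w +ʳ (-ʳ (im z *ʳ im w))) +i (re z *ʳ im w +ʳ im z *ʳ re w)

-ᶜ_ : ℂ → ℂ
-ᶜ z = (-ʳ re z) +i (-ʳ im z)

0ᶜ 1ᶜ : ℂ
0ᶜ = constʳ 0ℚ +i constʳ 0ℚ
1ᶜ = constʳ 1ℚ +i constʳ 0ℚ

-- The ring laws hold term by term for the representing sequences.

ℂ-commutativeRing : CommutativeRing 0ℓ 0ℓ
ℂ-commutativeRing = record
  { Carrier = ℂ ; _≈_ = _≈ᶜ_ ; _+_ = _+ᶜ_ ; _*_ = _*ᶜ_ ; -_ = -ᶜ_ ; 0# = 0ᶜ ; 1# = 1ᶜ
  ; isCommutativeRing = record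
    { isRing = record
      { +-isAbelianGroup = record
        { isGroup = record
          { isMonoid = record
            { isSemigroup = record
              { isMagma = record
                { isEquivalence = record
                  { refl  = λ {z} → ≈ʳ-refl {re z} , ≈ʳ-refl {im z}
                  ; sym   = λ {z} {w} (p , q) →
                      ≈ʳ-sym {re z} {re w} p , ≈ʳ-sym {im z} {im w} q
                  ; trans = λ {z} {w} {v} (p , q) (p′ , q′) →
                      ≈ʳ-trans {re z} {re w} {re v} p p′ , ≈ʳ-trans {im z} {im w} {im v} q q′
                  }
                ; ∙-cong = λ {z} {z′} {w} {w′} (p , q) (p′ , q′) →
                      +ʳ-cong {re z} {re z′} {re w} {re w′} p p′
                    , +ʳ-cong {im z} {im z′} {im w} {im w′} q q′
                }
              ; assoc = λ z w v → pointwise ((z +ᶜ w) +ᶜ v) (z +ᶜ (w +ᶜ v))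
                  (λ n → ℚₚ.+-assoc (reₙ z n) (reₙ w n) (reₙ v n))
                  (λ n → ℚₚ.+-assoc (imₙ z n) (imₙ w n) (imₙ v n))
              }
            ; identity = (λ z → pointwise (0ᶜ +ᶜ z) z (λ n → ℚₚ.+-identityˡ (reₙ z n)) (λ n → ℚₚ.+-identityˡ (imₙ z n)))
                       , (λ z → pointwise (z +ᶜ 0ᶜ) z (λ n → ℚₚ.+-identityʳ (reₙ z n)) (λ n → ℚₚ.+-identityʳ (imₙ z n)))
            }
          ; inverse = (λ z → pointwise ((-ᶜ z) +ᶜ z) 0ᶜ (λ n → ℚₚ.+-inverseˡ (reₙ z n)) (λ n → ℚₚ.+-inverseˡ (imₙ z n)))
                    , (λ z → pointwise (z +ᶜ (-ᶜ z)) 0ᶜ (λ n → ℚₚ.+-inverseʳ (reₙ z n)) (λ n → ℚₚ.+-inverseʳ (imₙ z n)))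
          ; ⁻¹-cong = λ {z} {w} (p , q) → -ʳ-cong {re z} {re w} p , -ʳ-cong {im z} {im w} q
          }
        ; comm = λ z w → pointwise (z +ᶜ w) (w +ᶜ z)
            (λ n → ℚₚ.+-comm (reₙ z n) (reₙ w n))
            (λ n → ℚₚ.+-comm (imₙ z n) (imₙ w n))
        }
      ; *-cong = λ {z} {z′} {w} {w′} → *ᶜ-cong {z} {z′} {w} {w′}
      ; *-assoc = λ z w v → pointwise ((z *ᶜ w) *ᶜ v) (z *ᶜ (w *ᶜ v))
          (λ n → assoc-re (reₙ z n) (imₙ z n) (reₙ w n) (imₙ w n) (reₙ v n) (imₙ v n))
          (λ n → assoc-im (reₙ z n) (imₙ z n) (reₙ w n) (imₙ w n) (reₙ v n) (imₙ v n))
      ; *-identity =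
            (λ z → pointwise (1ᶜ *ᶜ z) z (λ n → idˡ-re (reₙ z n) (imₙ z n)) (λ n → idˡ-im (reₙ z n) (imₙ z n)))
          , (λ z → pointwise (z *ᶜ 1ᶜ) z (λ n → idʳ-re (reₙ z n) (imₙ z n)) (λ n → idʳ-im (reₙ z n) (imₙ z n)))
      ; distrib =
            (λ z w v → pointwise (z *ᶜ (w +ᶜ v)) ((z *ᶜ w) +ᶜ (z *ᶜ v))
              (λ n → distribˡ-re (reₙ z n) (imₙ z n) (reₙ w n) (imₙ w n) (reₙ v n) (imₙ v n))
              (λ n → distribˡ-im (reₙ z n) (imₙ z n) (reₙ w n) (imₙ w n) (reₙ v n) (imₙ v n)))
          , (λ z w v → pointwise ((w +ᶜ v) *ᶜ z) ((w *ᶜ z) +ᶜ (v *ᶜ z))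
              (λ n → distribʳ-re (reₙ z n) (imₙ z n) (reₙ w n) (imₙ w n) (reₙ v n) (imₙ v n))
              (λ n → distribʳ-im (reₙ z n) (imₙ z n) (reₙ w n) (imₙ w n) (reₙ v n) (imₙ v n)))
      }
    ; *-comm = λ z w → pointwise (z *ᶜ w) (w *ᶜ z)
        (λ n → comm-re (reₙ z n) (imₙ z n) (reₙ w n) (imₙ w n))
        (λ n → comm-im (reₙ z n) (imₙ z n) (reₙ w n) (imₙ w n))
    }
  }
  where
  open Rational using (_+_; _*_; -_)
  open ℚ-Solver.+-*-Solver

  reₙ imₙ : ℂ → ℕ → ℚ
  reₙ z = seq (re z)
  imₙ z = seq (im z)

  pointwise : ∀ z w → (∀ n → reₙ z n ≡ reₙ w n) → (∀ n → imₙ z n ≡ imₙ w n) → z ≈ᶜ w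
  pointwise z w p q = pointwise⇒≈ʳ (re z) (re w) p , pointwise⇒≈ʳ (im z) (im w) q

  *ᶜ-cong : ∀ {z z′ w w′} → z ≈ᶜ z′ → w ≈ᶜ w′ → (z *ᶜ w) ≈ᶜ (z′ *ᶜ w′)
  *ᶜ-cong {a +i b} {a′ +i b′} {c +i d} {c′ +i d′} (p , q) (p′ , q′) =
      +ʳ-cong {a *ʳ c} {a′ *ʳ c′} { -ʳ (b *ʳ d)} { -ʳ (b′ *ʳ d′)}
        (*ʳ-cong {a} {a′} {c} {c′} p p′)
        (-ʳ-cong {b *ʳ d} {b′ *ʳ d′} (*ʳ-cong {b} {b′} {d} {d′} q q′))
    , +ʳ-cong {a *ʳ d} {a′ *ʳ d′} {b *ʳ c} {b′ *ʳ c′}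
        (*ʳ-cong {a} {a′} {d} {d′} p q′)
        (*ʳ-cong {b} {b′} {c} {c′} q p′)

  assoc-re : ∀ a b c d e f →
    (a * c + - (b * d)) * e + - ((a * d + b * c) * f) ≡
    a * (c * e + - (d * f)) + - (b * (c * f + d * e))
  assoc-re = solve 6 (λ a b c d e f →
    (a :* c :+ :- (b :* d)) :* e :+ :- ((a :* d :+ b :* c) :* f) :=
    a :* (c :* e :+ :- (d :* f)) :+ :- (b :* (c :* f :+ d :* e))) refl

  assoc-im : ∀ a b c d e f →
    (a * c + - (b * d)) * f + (a * d + b * c) * e ≡
    a * (c * f + d * e) + b * (c * e + - (d * f))
  assoc-im = solve 6 (λ a b c d e f →
    (a :* c :+ :- (b :* d)) :* f :+ (a :* d :+ b :* c) :* e :=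
    a :* (c :* f :+ d :* e) :+ b :* (c :* e :+ :- (d :* f))) refl

  idˡ-re : ∀ a b → 1ℚ * a + - (0ℚ * b) ≡ a
  idˡ-re = solve 2 (λ a b → con 1ℚ :* a :+ :- (con 0ℚ :* b) := a) refl

  idˡ-im : ∀ a b → 1ℚ * b + 0ℚ * a ≡ b
  idˡ-im = solve 2 (λ a b → con 1ℚ :* b :+ con 0ℚ :* a := b) refl

  idʳ-re : ∀ a b → a * 1ℚ + - (b * 0ℚ) ≡ a
  idʳ-re = solve 2 (λ a b → a :* con 1ℚ :+ :- (b :* con 0ℚ) := a) refl

  idʳ-im : ∀ a b → a * 0ℚ + b * 1ℚ ≡ b
  idʳ-im = solve 2 (λ a b → a :* con 0ℚ :+ b :* con 1ℚ := b) refl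

  distribˡ-re : ∀ a b c d e f →
    a * (c + e) + - (b * (d + f)) ≡ (a * c + - (b * d)) + (a * e + - (b * f))
  distribˡ-re = solve 6 (λ a b c d e f →
    a :* (c :+ e) :+ :- (b :* (d :+ f)) :=
    (a :* c :+ :- (b :* d)) :+ (a :* e :+ :- (b :* f))) refl

  distribˡ-im : ∀ a b c d e f →
    a * (d + f) + b * (c + e) ≡ (a * d + b * c) + (a * f + b * e)
  distribˡ-im = solve 6 (λ a b c d e f →
    a :* (d :+ f) :+ b :* (c :+ e) := (a :* d :+ b :* c) :+ (a :* f :+ b :* e)) refl

  distribʳ-re : ∀ a b c d e f →
    (c + e) * a + - ((d + f) * b) ≡ (c * a + - (d * b)) + (e * a + - (f * b))
  distribʳ-re = solve 6 (λ a b c d e f →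
    (c :+ e) :* a :+ :- ((d :+ f) :* b) :=
    (c :* a :+ :- (d :* b)) :+ (e :* a :+ :- (f :* b))) refl

  distribʳ-im : ∀ a b c d e f →
    (c + e) * b + (d + f) * a ≡ (c * b + d * a) + (e * b + f * a)
  distribʳ-im = solve 6 (λ a b c d e f →
    (c :+ e) :* b :+ (d :+ f) :* a := (c :* b :+ d :* a) :+ (e :* b :+ f :* a)) refl

  comm-re : ∀ a b c d → a * c + - (b * d) ≡ c * a + - (d * b)
  comm-re = solve 4 (λ a b c d → a :* c :+ :- (b :* d) := c :* a :+ :- (d :* b)) refl

  comm-im : ∀ a b c d → a * d + b * c ≡ c * b + d * a
  comm-im = solve 4 (λ a b c d → a :* d :+ b :* c := c :* b :+ d :* a) refl

-- Coefficient lists, lowest degree first; trailing zeros are not significant.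
ℤ[q] : Set
ℤ[q] = List ℤ

module RingNotions {a ℓ} (R : CommutativeRing a ℓ) where
  open CommutativeRing R
  open import Algebra.Definitions _≈_ using (Invertible)
  open import Algebra.Definitions.RawMonoid +-rawMonoid using () renaming (_×_ to _∙_)
  open import Algebra.Properties.Semiring.Exp semiring using (_^_)

  fromInteger : ℤ → Carrier
  fromInteger (+ n)    = n ∙ 1#
  fromInteger -[1+ n ] = - (suc n ∙ 1#)

  eval : ℤ[q] → Carrier → Carrier
  eval []      x = 0#
  eval (a ∷ p) x = fromInteger a + x * eval p x

  IsPrimitiveRoot : ℕ → Carrier → Set ℓ
  IsPrimitiveRoot n ζ = ζ ^ n ≈ 1# × (∀ m → 0 ℕ.< m → m ℕ.< n → ¬ (ζ ^ m ≈ 1#))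

  IsUnit : Carrier → Set (a ⊔ ℓ)
  IsUnit = Invertible 1# _*_

  root-isUnit : ∀ {n ζ} .{{_ : NonZero n}} → IsPrimitiveRoot n ζ → IsUnit ζ
  root-isUnit {suc n} {ζ} (ζⁿ≈1 , _) = ζ ^ n , CommutativeRing.trans R (*-comm (ζ ^ n) ζ) ζⁿ≈1 , ζⁿ≈1

  zpow : (x : Carrier) → IsUnit x → ℤ → Carrier
  zpow x _         (+ n)    = x ^ n
  zpow x (x⁻¹ , _) -[1+ n ] = x⁻¹ ^ suc n

coeff : ℤ[q] → ℕ → ℤ
coeff []      _       = 0ℤ
coeff (a ∷ p) zero    = a
coeff (a ∷ p) (suc n) = coeff p n

infix 4 _≋_

record _≋_ (p p′ : ℤ[q]) : Set where
  constructor coeffwise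
  field
    coeff-≡ : ∀ n → coeff p n ≡ coeff p′ n

open _≋_ public

infixl 6 _+ᵖ_
infixl 7 _*ᵖ_
infixr 8 _·ᵖ_ q^_·_

_+ᵖ_ : ℤ[q] → ℤ[q] → ℤ[q]
[]      +ᵖ p′       = p′
(a ∷ p) +ᵖ []       = a ∷ p
(a ∷ p) +ᵖ (b ∷ p′) = a ℤ.+ b ∷ p +ᵖ p′

_·ᵖ_ : ℤ → ℤ[q] → ℤ[q]
a ·ᵖ p = map (a ℤ.*_) p

_*ᵖ_ : ℤ[q] → ℤ[q] → ℤ[q]
[]      *ᵖ p′ = []
(a ∷ p) *ᵖ p′ = a ·ᵖ p′ +ᵖ (0ℤ ∷ p *ᵖ p′)

q^_·_ : ℕ → ℤ[q] → ℤ[q]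
q^ zero  · p = p
q^ suc n · p = 0ℤ ∷ q^ n · p

-- p /q^ m stands for q⁻ᵐ p
record ℤ[q,q⁻¹] : Set where
  constructor _/q^_
  field
    num   : ℤ[q]
    shift : ℕ

infixl 6 _+ᴸ_
infixl 7 _*ᴸ_ _*ᴹ_
infix  4 _/q^_

_+ᴸ_ _*ᴸ_ : ℤ[q,q⁻¹] → ℤ[q,q⁻¹] → ℤ[q,q⁻¹]
(p /q^ m) +ᴸ (p′ /q^ m′) = q^ m′ · p +ᵖ q^ m · p′ /q^ m ℕ.+ m′
(p /q^ m) *ᴸ (p′ /q^ m′) = p *ᵖ p′ /q^ m ℕ.+ m′

0ᴸ 1ᴸ qᴸ -q⁻¹ : ℤ[q,q⁻¹]
0ᴸ   = [] /q^ 0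
1ᴸ   = 1ℤ ∷ [] /q^ 0
qᴸ   = 0ℤ ∷ 1ℤ ∷ [] /q^ 0
-q⁻¹ = -1ℤ ∷ [] /q^ 1

infix 4 _Represents_

-- q⁻ᵐ n = p, with denominators cleared.
_Represents_ : ℤ[q] → ℤ[q,q⁻¹] → Set
p Represents (n /q^ m) = n ≋ q^ m · p

record Matrix : Set where
  constructor matrix
  field
    m₁₁ m₁₂ m₂₁ m₂₂ : ℤ[q,q⁻¹]

open Matrix public

_*ᴹ_ : Matrix → Matrix → Matrix
matrix a b c d *ᴹ matrix a′ b′ c′ d′ = matrix
  (a *ᴸ a′ +ᴸ b *ᴸ c′) (a *ᴸ b′ +ᴸ b *ᴸ d′)
  (c *ᴸ a′ +ᴸ d *ᴸ c′) (c *ᴸ b′ +ᴸ d *ᴸ d′)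

I Rq Sq : Matrix
I  = matrix 1ᴸ 0ᴸ
            0ᴸ 1ᴸ
Rq = matrix qᴸ 1ᴸ
            0ᴸ 1ᴸ
Sq = matrix 0ᴸ -q⁻¹
            1ᴸ 0ᴸ

Rq^_ : ℕ → Matrix
Rq^ zero  = I
Rq^ suc c = Rq *ᴹ Rq^ c

Mq : ∀ {k} → Vec ℕ k → Matrix
Mq []       = I
Mq (c ∷ cs) = Rq^ c *ᴹ Sq *ᴹ Mq cs

private
  coeff-+ᵖ : ∀ p p′ n → coeff (p +ᵖ p′) n ≡ coeff p n ℤ.+ coeff p′ n
  coeff-+ᵖ []      p′       n       = sym (ℤₚ.+-identityˡ (coeff p′ n))
  coeff-+ᵖ (a ∷ p) []       n       = sym (ℤₚ.+-identityʳ (coeff (a ∷ p) n))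
  coeff-+ᵖ (a ∷ p) (b ∷ p′) zero    = refl
  coeff-+ᵖ (a ∷ p) (b ∷ p′) (suc n) = coeff-+ᵖ p p′ n

  coeff-·ᵖ : ∀ a p n → coeff (a ·ᵖ p) n ≡ a ℤ.* coeff p n
  coeff-·ᵖ a []      n       = sym (ℤₚ.*-zeroʳ a)
  coeff-·ᵖ a (b ∷ p) zero    = refl
  coeff-·ᵖ a (b ∷ p) (suc n) = coeff-·ᵖ a p n

  ≋-refl : ∀ {p} → p ≋ p
  ≋-refl = coeffwise λ _ → refl

  ≋-sym : ∀ {p p′} → p ≋ p′ → p′ ≋ p
  ≋-sym e = coeffwise λ n → sym (coeff-≡ e n)

  ≋-trans : ∀ {p p′ p″} → p ≋ p′ → p′ ≋ p″ → p ≋ p″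
  ≋-trans e e′ = coeffwise λ n → trans (coeff-≡ e n) (coeff-≡ e′ n)

  ≡⇒≋ : ∀ {p p′} → p ≡ p′ → p ≋ p′
  ≡⇒≋ refl = ≋-refl

  tail-≋ : ∀ {a p b p′} → (a ∷ p) ≋ (b ∷ p′) → p ≋ p′
  tail-≋ e = coeffwise λ n → coeff-≡ e (suc n)

  ∷-cong : ∀ {a b p p′} → a ≡ b → p ≋ p′ → (a ∷ p) ≋ (b ∷ p′)
  ∷-cong e e′ = coeffwise λ { zero → e ; (suc n) → coeff-≡ e′ n }

  +ᵖ-cong : ∀ {p p′ r r′} → p ≋ p′ → r ≋ r′ → p +ᵖ r ≋ p′ +ᵖ r′
  +ᵖ-cong {p} {p′} {r} {r′} e e′ = coeffwise λ n → begin
    coeff (p +ᵖ r) n           ≡⟨ coeff-+ᵖ p r n ⟩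
    coeff p n ℤ.+ coeff r n    ≡⟨ cong₂ ℤ._+_ (coeff-≡ e n) (coeff-≡ e′ n) ⟩
    coeff p′ n ℤ.+ coeff r′ n  ≡⟨ coeff-+ᵖ p′ r′ n ⟨
    coeff (p′ +ᵖ r′) n         ∎
    where open ≡-Reasoning

  ·ᵖ-cong : ∀ {a b p p′} → a ≡ b → p ≋ p′ → a ·ᵖ p ≋ b ·ᵖ p′
  ·ᵖ-cong {a} {b} {p} {p′} e e′ = coeffwise λ n → begin
    coeff (a ·ᵖ p) n    ≡⟨ coeff-·ᵖ a p n ⟩
    a ℤ.* coeff p n     ≡⟨ cong₂ ℤ._*_ e (coeff-≡ e′ n) ⟩
    b ℤ.* coeff p′ n    ≡⟨ coeff-·ᵖ b p′ n ⟨
    coeff (b ·ᵖ p′) n   ∎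
    where open ≡-Reasoning

  0·ᵖ : ∀ p → 0ℤ ·ᵖ p ≋ []
  0·ᵖ p = coeffwise (coeff-·ᵖ 0ℤ p)

  0∷[] : 0ℤ ∷ [] ≋ []
  0∷[] = coeffwise λ { zero → refl ; (suc _) → refl }

  *ᵖ-zero : ∀ {p} → p ≋ [] → ∀ r → p *ᵖ r ≋ []
  *ᵖ-zero {[]}    e r = ≋-refl
  *ᵖ-zero {a ∷ p} e r = +ᵖ-cong
    (≋-trans (·ᵖ-cong {p = r} (coeff-≡ e 0) ≋-refl) (0·ᵖ r))
    (≋-trans (∷-cong refl (*ᵖ-zero {p} (tail-≋ (≋-trans e (≋-sym 0∷[]))) r)) 0∷[])

  *ᵖ-cong : ∀ {p p′ r r′} → p ≋ p′ → r ≋ r′ → p *ᵖ r ≋ p′ *ᵖ r′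
  *ᵖ-cong {[]}    {p′}     {r} {r′} e e′ = ≋-sym (*ᵖ-zero (≋-sym e) r′)
  *ᵖ-cong {a ∷ p} {[]}     {r} {r′} e e′ = *ᵖ-zero e r
  *ᵖ-cong {a ∷ p} {b ∷ p′} {r} {r′} e e′ =
    +ᵖ-cong (·ᵖ-cong (coeff-≡ e 0) e′) (∷-cong refl (*ᵖ-cong (tail-≋ e) e′))

  0∷-*ᵖ : ∀ p r → (0ℤ ∷ p) *ᵖ r ≋ 0ℤ ∷ p *ᵖ r
  0∷-*ᵖ p r = +ᵖ-cong (0·ᵖ r) ≋-refl

  *ᵖ-0∷ : ∀ p r → p *ᵖ (0ℤ ∷ r) ≋ 0ℤ ∷ p *ᵖ r
  *ᵖ-0∷ []      r = ≋-sym 0∷[]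
  *ᵖ-0∷ (a ∷ p) r = ∷-cong (trans (ℤₚ.+-identityʳ (a ℤ.* 0ℤ)) (ℤₚ.*-zeroʳ a))
    (+ᵖ-cong {a ·ᵖ r} ≋-refl (*ᵖ-0∷ p r))

  q^-cong : ∀ m {p p′} → p ≋ p′ → q^ m · p ≋ q^ m · p′
  q^-cong zero    e = e
  q^-cong (suc m) e = ∷-cong refl (q^-cong m e)

  q^-+ᵖ : ∀ m p r → q^ m · p +ᵖ q^ m · r ≡ q^ m · (p +ᵖ r)
  q^-+ᵖ zero    p r = refl
  q^-+ᵖ (suc m) p r = cong (0ℤ ∷_) (q^-+ᵖ m p r)

  q^-q^ : ∀ m n p → q^ m · q^ n · p ≡ q^ (m ℕ.+ n) · p
  q^-q^ zero    n p = refl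
  q^-q^ (suc m) n p = cong (0ℤ ∷_) (q^-q^ m n p)

  q^-*ᵖ : ∀ m p r → (q^ m · p) *ᵖ r ≋ q^ m · (p *ᵖ r)
  q^-*ᵖ zero    p r = ≋-refl
  q^-*ᵖ (suc m) p r = ≋-trans (0∷-*ᵖ (q^ m · p) r) (∷-cong refl (q^-*ᵖ m p r))

  *ᵖ-q^ : ∀ m p r → p *ᵖ (q^ m · r) ≋ q^ m · (p *ᵖ r)
  *ᵖ-q^ zero    p r = ≋-refl
  *ᵖ-q^ (suc m) p r = ≋-trans (*ᵖ-0∷ p (q^ m · r)) (∷-cong refl (*ᵖ-q^ m p r))

  -- x is q^k times an element of ℤ[q]
  Order≥ : ℕ → ℤ[q,q⁻¹] → Set
  Order≥ k x = ∃ λ p → (q^ k · p) Represents x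

  +-order : ∀ k x y → Order≥ k x → Order≥ k y → Order≥ k (x +ᴸ y)
  +-order k (n /q^ m) (n′ /q^ m′) (p , e) (p′ , e′) = p +ᵖ p′ ,
    ≋-trans (+ᵖ-cong {q^ m′ · n} (q^-cong m′ e) (q^-cong m e′)) (≡⇒≋ (begin
      q^ m′ · q^ m · q^ k · p +ᵖ q^ m · q^ m′ · q^ k · p′
        ≡⟨ cong₂ _+ᵖ_ (q^-q^ m′ m _) (q^-q^ m m′ _) ⟩
      q^ (m′ ℕ.+ m) · q^ k · p +ᵖ q^ (m ℕ.+ m′) · q^ k · p′
        ≡⟨ cong (λ j → q^ j · q^ k · p +ᵖ q^ (m ℕ.+ m′) · q^ k · p′) (ℕₚ.+-comm m′ m) ⟩
      q^ (m ℕ.+ m′) · q^ k · p +ᵖ q^ (m ℕ.+ m′) · q^ k · p′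
        ≡⟨ q^-+ᵖ (m ℕ.+ m′) _ _ ⟩
      q^ (m ℕ.+ m′) · (q^ k · p +ᵖ q^ k · p′)
        ≡⟨ cong (q^ (m ℕ.+ m′) ·_) (q^-+ᵖ k p p′) ⟩
      q^ (m ℕ.+ m′) · q^ k · (p +ᵖ p′) ∎))
    where open ≡-Reasoning

  *-represents : ∀ {p p′ x y} → p Represents x → p′ Represents y → (p *ᵖ p′) Represents (x *ᴸ y)
  *-represents {p} {p′} {n /q^ m} {n′ /q^ m′} e e′ = ≋-trans (*ᵖ-cong {n} {q^ m · p} e e′)
    (≋-trans (q^-*ᵖ m p (q^ m′ · p′)) (≋-trans (q^-cong m (*ᵖ-q^ m′ p p′))
      (≡⇒≋ (q^-q^ m m′ (p *ᵖ p′)))))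

  *-orderˡ : ∀ k x y → Order≥ k x → Order≥ 0 y → Order≥ k (x *ᴸ y)
  *-orderˡ k x@(_ /q^ m) y@(_ /q^ m′) (p , e) (p′ , e′) = p *ᵖ p′ ,
    ≋-trans (*-represents {q^ k · p} {p′} {x} {y} e e′) (q^-cong (m ℕ.+ m′) (q^-*ᵖ k p p′))

  *-orderʳ : ∀ k x y → Order≥ 0 x → Order≥ k y → Order≥ k (x *ᴸ y)
  *-orderʳ k x@(_ /q^ m) y@(_ /q^ m′) (p , e) (p′ , e′) = p *ᵖ p′ ,
    ≋-trans (*-represents {p} {q^ k · p′} {x} {y} e e′) (q^-cong (m ℕ.+ m′) (*ᵖ-q^ k p p′))

  *-q⁻¹-order : ∀ x → Order≥ 1 x → Order≥ 0 (x *ᴸ -q⁻¹)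
  *-q⁻¹-order (n /q^ m) (p , e) = p *ᵖ (-1ℤ ∷ []) ,
    ≋-trans (*ᵖ-cong {n} {q^ m · q^ 1 · p} e ≋-refl)
      (≋-trans (≡⇒≋ (cong (_*ᵖ (-1ℤ ∷ [])) (q^-q^ m 1 p)))
        (q^-*ᵖ (m ℕ.+ 1) p (-1ℤ ∷ [])))

  weaken : ∀ x → Order≥ 1 x → Order≥ 0 x
  weaken _ (p , e) = q^ 1 · p , e

  0-order : Order≥ 1 0ᴸ
  0-order = [] , ≋-sym 0∷[]

  1-order : Order≥ 0 1ᴸ
  1-order = 1ℤ ∷ [] , ≋-refl

  q-order : Order≥ 1 qᴸ
  q-order = 1ℤ ∷ [] , ≋-refl

  dot : ∀ k a b c d → Order≥ k (a *ᴸ b) → Order≥ k (c *ᴸ d) → Order≥ k (a *ᴸ b +ᴸ c *ᴸ d)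
  dot k a b c d = +-order k (a *ᴸ b) (c *ᴸ d)

  record Integral (A : Matrix) : Set where
    constructor integral
    field
      i₁₁ : Order≥ 0 (m₁₁ A)
      i₁₂ : Order≥ 0 (m₁₂ A)
      i₂₁ : Order≥ 0 (m₂₁ A)
      i₂₂ : Order≥ 0 (m₂₂ A)

  *ᴹ-integral : ∀ {A B} → Integral A → Integral B → Integral (A *ᴹ B)
  *ᴹ-integral {matrix a b c d} {matrix a′ b′ c′ d′} (integral p q r s) (integral p′ q′ r′ s′) = integral
    (dot 0 a a′ b c′ (*-orderˡ 0 a a′ p p′) (*-orderˡ 0 b c′ q r′))
    (dot 0 a b′ b d′ (*-orderˡ 0 a b′ p q′) (*-orderˡ 0 b d′ q s′))
    (dot 0 c a′ d c′ (*-orderˡ 0 c a′ r p′) (*-orderˡ 0 d c′ s r′))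
    (dot 0 c b′ d d′ (*-orderˡ 0 c b′ r q′) (*-orderˡ 0 d d′ s s′))

  I-integral : Integral I
  I-integral = integral 1-order (weaken 0ᴸ 0-order) (weaken 0ᴸ 0-order) 1-order

  R^-integral : ∀ c → Integral (Rq^ c)
  R^-integral zero    = I-integral
  R^-integral (suc c) =
    *ᴹ-integral {Rq} {Rq^ c}
      (integral (weaken qᴸ q-order) 1-order (weaken 0ᴸ 0-order) 1-order) (R^-integral c)

  R^₂₁ : ∀ c → Order≥ 1 (m₂₁ (Rq^ c))
  R^₂₁ zero    = 0-order
  R^₂₁ (suc c) = dot 1 0ᴸ x 1ᴸ y
    (*-orderˡ 1 0ᴸ x 0-order (Integral.i₁₁ (R^-integral c)))
    (*-orderʳ 1 1ᴸ y 1-order (R^₂₁ c))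
    where
    x = m₁₁ (Rq^ c)
    y = m₂₁ (Rq^ c)

  R^₁₁ : ∀ c → Order≥ 1 (m₁₁ (Rq^ suc c))
  R^₁₁ c = dot 1 qᴸ x 1ᴸ y
    (*-orderˡ 1 qᴸ x q-order (Integral.i₁₁ (R^-integral c)))
    (*-orderʳ 1 1ᴸ y 1-order (R^₂₁ c))
    where
    x = m₁₁ (Rq^ c)
    y = m₂₁ (Rq^ c)

  *S-integral : ∀ A → Integral A → Order≥ 1 (m₁₁ A) → Order≥ 1 (m₂₁ A) → Integral (A *ᴹ Sq)
  *S-integral (matrix a b c d) (integral p q r s) a≥1 c≥1 = integral
    (dot 0 a 0ᴸ b 1ᴸ (*-orderˡ 0 a 0ᴸ p 0₀) (*-orderˡ 0 b 1ᴸ q 1-order))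
    (dot 0 a -q⁻¹ b 0ᴸ (*-q⁻¹-order a a≥1) (*-orderˡ 0 b 0ᴸ q 0₀))
    (dot 0 c 0ᴸ d 1ᴸ (*-orderˡ 0 c 0ᴸ r 0₀) (*-orderˡ 0 d 1ᴸ s 1-order))
    (dot 0 c -q⁻¹ d 0ᴸ (*-q⁻¹-order c c≥1) (*-orderˡ 0 d 0ᴸ s 0₀))
    where
    0₀ = weaken 0ᴸ 0-order

  M-integral : ∀ {k} (c : Vec ℕ k) → All (2 ℕ.≤_) c → Integral (Mq c)
  M-integral []           _               = I-integral
  M-integral (suc c ∷ cs) (_ ∷ 2≤cs) =
    *ᴹ-integral {Rq^ suc c *ᴹ Sq} {Mq cs}
      (*S-integral (Rq^ suc c) (R^-integral (suc c)) (R^₁₁ c) (R^₂₁ (suc c)))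
      (M-integral cs 2≤cs)

upper-entry : ∀ {k} (c : Vec ℕ k) → All (2 ℕ.≤_) c → ∃ λ p → p Represents m₁₁ (Mq c)
upper-entry c 2≤c = Integral.i₁₁ (M-integral c 2≤c)

lower-entry : ∀ {k} (c : Vec ℕ k) → All (2 ℕ.≤_) c → ∃ λ p → p Represents m₂₁ (Mq c)
lower-entry c 2≤c = Integral.i₂₁ (M-integral c 2≤c)

⟦_,_⟧  : ∀ {n} (c : Vec ℕ (suc n)) → All (2 ℕ.≤_) c → ℚ
1<⟦_,_⟧ : ∀ {n} (c : Vec ℕ (suc n)) (2≤c : All (2 ℕ.≤_) c) → 1ℚ ℚ.< ⟦ c , 2≤c ⟧

private
  >1⇒pos : ∀ {x} → 1ℚ ℚ.< x → Positive x
  >1⇒pos {x} 1<x = ℚ.positive (ℚₚ.<-trans (ℚₚ.positive⁻¹ 1ℚ) 1<x)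

  >1⇒nonZero : ∀ {x} → 1ℚ ℚ.< x → ℚ.NonZero x
  >1⇒nonZero {x} 1<x = ℚₚ.pos⇒nonZero x {{>1⇒pos 1<x}}

  1/<1 : ∀ {x} (1<x : 1ℚ ℚ.< x) → (1/ x) {{>1⇒nonZero 1<x}} ℚ.< 1ℚ
  1/<1 {x} 1<x = ℚₚ.*-cancelʳ-<-nonNeg x {{ℚₚ.pos⇒nonNeg x {{>1⇒pos 1<x}}}}
    (subst₂ ℚ._<_ (sym (ℚₚ.*-inverseˡ x {{>1⇒nonZero 1<x}})) (sym (ℚₚ.*-identityˡ x)) 1<x)

  2≤fromℤ : ∀ {c} → 2 ℕ.≤ c → fromℤ (+ 2) ℚ.≤ fromℤ (+ c)
  2≤fromℤ 2≤c = ℚ.*≤* (ℤₚ.*-monoʳ-≤-nonNeg 1ℤ (ℤ.+≤+ 2≤c))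

⟦ c ∷ [] , _ ⟧                = fromℤ (+ c)
⟦ c ∷ cs@(_ ∷ _) , _ ∷ 2≤cs ⟧ = fromℤ (+ c) ℚ.- (1/ ⟦ cs , 2≤cs ⟧) {{>1⇒nonZero 1<⟦ cs , 2≤cs ⟧}}

1<⟦ c ∷ [] , 2≤c ∷ [] ⟧           = ℚₚ.<-≤-trans (ℚ.*<* (ℤ.+<+ ℕₚ.≤-refl)) (2≤fromℤ 2≤c)
1<⟦ c ∷ cs@(_ ∷ _) , 2≤c ∷ 2≤cs ⟧ =
  ℚₚ.+-mono-≤-< (2≤fromℤ 2≤c) (ℚₚ.neg-antimono-< (1/<1 1<⟦ cs , 2≤cs ⟧))

-- k ≥ 1 since the continued fraction has at least one term.
record HJExpansion (x : ℚ) : Set where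
  field
    {n}   : ℕ
    c     : Vec ℕ (suc n)
    2≤c   : All (2 ℕ.≤_) c
    value : x ≡ ⟦ c , 2≤c ⟧

  k : ℕ
  k = suc n

  C : ℕ → ℕ
  C i = sum (take i (toList c))

  -- The first column of M_q(c₁,…,c_k), as polynomials.
  𝓡 𝓢 : ℤ[q]
  𝓡 = proj₁ (upper-entry c 2≤c)
  𝓢 = proj₁ (lower-entry c 2≤c)

-- Over any commutative ring with a unit z such that z² - z + 1 = 0, the matrix R_z^c is
-- ((z^c, z - z^(c+1)), (0, 1)), so the first column (x, y) of M_z(c₂,…,c_k) becomes
-- ((z - z^(c+1)) x - z^(c-1) y, x) for M_z(c,c₂,…,c_k). The two closed formulas satisfy
-- this recursion because z⁻² = -z and z⁻³ = -1. A primitive sixth root of unity ζ ∈ ℂ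
-- satisfies ζ² - ζ + 1 = 0 because ℂ has no zero divisors.
module Submission where

open import Defs
open import Algebra.Bundles using (CommutativeRing)
open import Data.Fin.Base using (Fin; toℕ)
open import Data.Integer.Base as ℤ using (ℤ; +_; -[1+_]; 0ℤ; 1ℤ; -1ℤ)
import Data.Integer.Properties as ℤ
open import Data.List.Base using ([]; _∷_; take)
open import Data.Maybe.Base using (Maybe; map)
open import Data.Nat.Base as ℕ using (ℕ; zero; suc; NonZero)
import Data.Nat.Properties as ℕ
open import Data.Nat.Coprimality using (Coprime)
open import Data.Nat.ListAction using (sum)
open import Data.Product.Base using (∃; _×_; _,_; proj₁; proj₂)
open import Data.Rational.Base as ℚ using (ℚ)
import Data.Rational.Properties as ℚₚ
import Data.Rational.Solver as ℚ-Solver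
open import Data.Sum.Base using (inj₁; inj₂)
open import Data.Vec.Base using (Vec; []; _∷_; toList)
open import Relation.Binary.PropositionalEquality as ≡ using (_≡_)
open import Relation.Nullary.Decidable using (Dec; yes; no; dec⇒maybe)
open import Relation.Nullary.Negation.Core using (¬_; contradiction)
import Algebra.Solver.Ring
open import Algebra.Solver.Ring.AlmostCommutativeRing
  using (_-Raw-AlmostCommutative⟶_; fromCommutativeRing)

-- Evaluation of integer polynomials in a commutative ring.

module Evaluation {a ℓ} (R : CommutativeRing a ℓ) where
  open CommutativeRing R hiding (zero)
  open RingNotions R using (fromInteger; eval; IsUnit; zpow)
  open import Algebra.Properties.Ring ring
    using (-0#≈0#; -1*x≈-x; -‿involutive; -‿distribˡ-*; -‿+-comm)
  open import Algebra.Properties.Semiring.Exp semiring using (_^_; ^-homo-*)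
  open import Algebra.Properties.Semiring.Mult semiring using (×-homo-+) renaming (_×_ to _·_)
  open import Relation.Binary.Reasoning.Setoid setoid

  -- Sums of opposite signs compute to `⊖`, so `fromInteger-+` rests on this case. The induction
  -- cancels one `1#` from each side.
  fromInteger-⊖ : ∀ m n → fromInteger (m ℤ.⊖ n) ≈ m · 1# - n · 1#
  fromInteger-⊖ m       zero    = begin
    m · 1#         ≈⟨ +-identityʳ _ ⟨
    m · 1# + 0#    ≈⟨ +-congˡ -0#≈0# ⟨
    m · 1# - 0#    ∎
  fromInteger-⊖ zero    (suc n) = sym (+-identityˡ _)
  fromInteger-⊖ (suc m) (suc n) = begin
    fromInteger (suc m ℤ.⊖ suc n)              ≡⟨ ≡.cong fromInteger (ℤ.[1+m]⊖[1+n]≡m⊖n m n) ⟩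
    fromInteger (m ℤ.⊖ n)                      ≈⟨ fromInteger-⊖ m n ⟩
    m · 1# - n · 1#                            ≈⟨ +-congʳ (+-identityʳ _) ⟨
    (m · 1# + 0#) - n · 1#                     ≈⟨ +-congʳ (+-congˡ (-‿inverseʳ 1#)) ⟨
    (m · 1# + (1# - 1#)) - n · 1#              ≈⟨ +-congʳ (+-assoc _ _ _) ⟨
    ((m · 1# + 1#) - 1#) - n · 1#              ≈⟨ +-congʳ (+-congʳ (+-comm _ _)) ⟩
    ((1# + m · 1#) - 1#) - n · 1#              ≈⟨ +-assoc _ _ _ ⟩
    (1# + m · 1#) + (- 1# - n · 1#)            ≈⟨ +-congˡ (-‿+-comm 1# (n · 1#)) ⟩
    suc m · 1# - suc n · 1#                    ∎

  fromInteger-neg : ∀ j → fromInteger (ℤ.- j) ≈ - fromInteger j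
  fromInteger-neg (+ zero)  = sym -0#≈0#
  fromInteger-neg (+ suc n) = refl
  fromInteger-neg -[1+ n ]  = sym (-‿involutive _)

  fromInteger-+ : ∀ j k → fromInteger (j ℤ.+ k) ≈ fromInteger j + fromInteger k
  fromInteger-+ (+ m)    (+ n)    = ×-homo-+ 1# m n
  fromInteger-+ (+ m)    -[1+ n ] = fromInteger-⊖ m (suc n)
  fromInteger-+ -[1+ m ] (+ n)    = trans (fromInteger-⊖ n (suc m)) (+-comm _ _)
  fromInteger-+ -[1+ m ] -[1+ n ] = begin
    - (suc (suc (m ℕ.+ n)) · 1#)     ≡⟨ ≡.cong (λ l → - (suc l · 1#)) (ℕ.+-suc m n) ⟨
    - ((suc m ℕ.+ suc n) · 1#)       ≈⟨ -‿cong (×-homo-+ 1# (suc m) (suc n)) ⟩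
    - (suc m · 1# + suc n · 1#)      ≈⟨ -‿+-comm _ _ ⟨
    - (suc m · 1#) - suc n · 1#      ∎

  -- Induction on a nonnegative left factor, with the right one of any sign, leaves `fromInteger-*`
  -- only a minus sign to pull out.
  fromInteger-+* : ∀ m k → fromInteger (+ m ℤ.* k) ≈ fromInteger (+ m) * fromInteger k
  fromInteger-+* zero    k = begin
    fromInteger (0ℤ ℤ.* k)     ≡⟨ ≡.cong fromInteger (ℤ.*-zeroˡ k) ⟩
    0#                         ≈⟨ zeroˡ _ ⟨
    0# * fromInteger k         ∎
  fromInteger-+* (suc m) k = begin
    fromInteger (+ suc m ℤ.* k)                            ≡⟨ ≡.cong fromInteger (ℤ.suc-* (+ m) k) ⟩
    fromInteger (k ℤ.+ + m ℤ.* k)                          ≈⟨ fromInteger-+ k (+ m ℤ.* k) ⟩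
    fromInteger k + fromInteger (+ m ℤ.* k)                ≈⟨ +-cong (sym (*-identityˡ _)) (fromInteger-+* m k) ⟩
    1# * fromInteger k + fromInteger (+ m) * fromInteger k ≈⟨ distribʳ _ _ _ ⟨
    fromInteger (+ suc m) * fromInteger k                  ∎

  fromInteger-* : ∀ j k → fromInteger (j ℤ.* k) ≈ fromInteger j * fromInteger k
  fromInteger-* (+ m)    k = fromInteger-+* m k
  fromInteger-* -[1+ m ] k = begin
    fromInteger (-[1+ m ] ℤ.* k)           ≡⟨ ≡.cong fromInteger (ℤ.neg-distribˡ-* (+ suc m) k) ⟨
    fromInteger (ℤ.- (+ suc m ℤ.* k))      ≈⟨ fromInteger-neg (+ suc m ℤ.* k) ⟩
    - fromInteger (+ suc m ℤ.* k)          ≈⟨ -‿cong (fromInteger-+* (suc m) k) ⟩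
    - (fromInteger (+ suc m) * fromInteger k) ≈⟨ -‿distribˡ-* _ _ ⟩
    fromInteger -[1+ m ] * fromInteger k   ∎

  -- Gives the ring solver integer coefficients, which can be compared even though equality in `R`
  -- need not be decidable.
  fromInteger-morphism : ℤ.+-*-rawRing -Raw-AlmostCommutative⟶ fromCommutativeRing R
  fromInteger-morphism = record
    { ⟦_⟧    = fromInteger
    ; +-homo = fromInteger-+
    ; *-homo = fromInteger-*
    ; -‿homo = fromInteger-neg
    ; 0-homo = refl
    ; 1-homo = +-identityʳ 1#
    }

  fromInteger-≟ : ∀ j k → Maybe (fromInteger j ≈ fromInteger k)
  fromInteger-≟ j k = map (λ j≡k → reflexive (≡.cong fromInteger j≡k)) (dec⇒maybe (j ℤ.≟ k))

  -- con 1ℤ denotes fromInteger 1ℤ, that is 1# + 0#; goals about 1# itself are made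
  -- homogeneous and 1# is passed to the solver as a variable o.
  open Algebra.Solver.Ring ℤ.+-*-rawRing (fromCommutativeRing R) fromInteger-morphism fromInteger-≟
    public using (solve; _:=_; _:+_; _:*_; _:-_; :-_; con)

  module _ (x : Carrier) where

    eval-+ᵖ : ∀ p r → eval (p +ᵖ r) x ≈ eval p x + eval r x
    eval-+ᵖ []      r       = sym (+-identityˡ _)
    eval-+ᵖ (c ∷ p) []      = sym (+-identityʳ _)
    eval-+ᵖ (c ∷ p) (d ∷ r) = begin
      fromInteger (c ℤ.+ d) + x * eval (p +ᵖ r) x
        ≈⟨ +-cong (fromInteger-+ c d) (*-congˡ (eval-+ᵖ p r)) ⟩
      (fromInteger c + fromInteger d) + x * (eval p x + eval r x)
        ≈⟨ solve 5 (λ c d x p r → (c :+ d) :+ x :* (p :+ r) := (c :+ x :* p) :+ (d :+ x :* r)) refl _ _ _ _ _ ⟩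
      (fromInteger c + x * eval p x) + (fromInteger d + x * eval r x) ∎

    eval-·ᵖ : ∀ c p → eval (c ·ᵖ p) x ≈ fromInteger c * eval p x
    eval-·ᵖ c []      = sym (zeroʳ _)
    eval-·ᵖ c (d ∷ p) = begin
      fromInteger (c ℤ.* d) + x * eval (c ·ᵖ p) x
        ≈⟨ +-cong (fromInteger-* c d) (*-congˡ (eval-·ᵖ c p)) ⟩
      fromInteger c * fromInteger d + x * (fromInteger c * eval p x)
        ≈⟨ solve 4 (λ c d x p → c :* d :+ x :* (c :* p) := c :* (d :+ x :* p)) refl _ _ _ _ ⟩
      fromInteger c * (fromInteger d + x * eval p x) ∎

    eval-*ᵖ : ∀ p r → eval (p *ᵖ r) x ≈ eval p x * eval r x
    eval-*ᵖ []      r = sym (zeroˡ _)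
    eval-*ᵖ (c ∷ p) r = begin
      eval (c ·ᵖ r +ᵖ (0ℤ ∷ p *ᵖ r)) x
        ≈⟨ eval-+ᵖ (c ·ᵖ r) (0ℤ ∷ p *ᵖ r) ⟩
      eval (c ·ᵖ r) x + (0# + x * eval (p *ᵖ r) x)
        ≈⟨ +-cong (eval-·ᵖ c r) (+-congˡ (*-congˡ (eval-*ᵖ p r))) ⟩
      fromInteger c * eval r x + (0# + x * (eval p x * eval r x))
        ≈⟨ solve 4 (λ c x p r → c :* r :+ (con 0ℤ :+ x :* (p :* r)) := (c :+ x :* p) :* r) refl _ _ _ _ ⟩
      (fromInteger c + x * eval p x) * eval r x ∎

    eval-q^ : ∀ m p → eval (q^ m · p) x ≈ x ^ m * eval p x
    eval-q^ zero    p = sym (*-identityˡ _)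
    eval-q^ (suc m) p = begin
      0# + x * eval (q^ m · p) x   ≈⟨ +-identityˡ _ ⟩
      x * eval (q^ m · p) x        ≈⟨ *-congˡ (eval-q^ m p) ⟩
      x * (x ^ m * eval p x)       ≈⟨ *-assoc _ _ _ ⟨
      x ^ suc m * eval p x         ∎

    -- Trailing zeros are allowed, so `p` need not be empty; this settles lists of different lengths
    -- in `eval-≋`.
    eval-≋[] : ∀ p → p ≋ [] → eval p x ≈ 0#
    eval-≋[] []      _ = refl
    eval-≋[] (c ∷ p) e = begin
      fromInteger c + x * eval p x
        ≈⟨ +-cong (reflexive (≡.cong fromInteger (coeff-≡ e 0)))
                  (*-congˡ (eval-≋[] p (coeffwise λ n → coeff-≡ e (suc n)))) ⟩
      0# + x * 0#   ≈⟨ +-identityˡ _ ⟩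
      x * 0#        ≈⟨ zeroʳ _ ⟩
      0#            ∎

    eval-≋ : ∀ p r → p ≋ r → eval p x ≈ eval r x
    eval-≋ []      r       e = sym (eval-≋[] r (coeffwise λ n → ≡.sym (coeff-≡ e n)))
    eval-≋ (c ∷ p) []      e = eval-≋[] (c ∷ p) e
    eval-≋ (c ∷ p) (d ∷ r) e = +-cong (reflexive (≡.cong fromInteger (coeff-≡ e 0)))
      (*-congˡ (eval-≋ p r (coeffwise λ n → coeff-≡ e (suc n))))

  -- Values of Laurent polynomials at a unit.

  module LaurentValues (z : Carrier) (z-unit : IsUnit z) where
    open import Algebra.Properties.Semiring.Exp semiring using (^-congˡ)
    open import Algebra.Properties.CommutativeSemiring.Exp commutativeSemiring using (^-distrib-*)

    i : Carrier
    i = proj₁ z-unit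

    i*z≈1 : i * z ≈ 1#
    i*z≈1 = proj₁ (proj₂ z-unit)

    1^ : ∀ m → 1# ^ m ≈ 1#
    1^ zero    = refl
    1^ (suc m) = trans (*-identityˡ _) (1^ m)

    i^*z^ : ∀ m → i ^ m * z ^ m ≈ 1#
    i^*z^ m = begin
      i ^ m * z ^ m   ≈⟨ ^-distrib-* i z m ⟨
      (i * z) ^ m     ≈⟨ ^-congˡ m i*z≈1 ⟩
      1# ^ m          ≈⟨ 1^ m ⟩
      1#              ∎

    z^-cancelˡ : ∀ m {x y} → z ^ m * x ≈ z ^ m * y → x ≈ y
    z^-cancelˡ m {x} {y} eq = begin
      x                      ≈⟨ unit x ⟩
      i ^ m * (z ^ m * x)    ≈⟨ *-congˡ eq ⟩
      i ^ m * (z ^ m * y)    ≈⟨ unit y ⟨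
      y                      ∎
      where
      unit : ∀ x → x ≈ i ^ m * (z ^ m * x)
      unit x = begin
        x                      ≈⟨ *-identityˡ x ⟨
        1# * x                 ≈⟨ *-congʳ (i^*z^ m) ⟨
        i ^ m * z ^ m * x      ≈⟨ *-assoc _ _ _ ⟩
        i ^ m * (z ^ m * x)    ∎

    infix 4 _↦_

    -- x takes the value v at q = z, with denominators cleared.
    record _↦_ (x : ℤ[q,q⁻¹]) (v : Carrier) : Set ℓ where
      constructor value
      open ℤ[q,q⁻¹] x
      field
        num-value : eval num z ≈ z ^ shift * v

    ↦-cong : ∀ {x v w} → v ≈ w → x ↦ v → x ↦ w
    ↦-cong v≈w (value e) = value (trans e (*-congˡ v≈w))

    +-↦ : ∀ {x y v w} → x ↦ v → y ↦ w → x +ᴸ y ↦ v + w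
    +-↦ {p /q^ m} {r /q^ n} {v} {w} (value e) (value f) = value (begin
      eval (q^ n · p +ᵖ q^ m · r) z                ≈⟨ eval-+ᵖ z (q^ n · p) (q^ m · r) ⟩
      eval (q^ n · p) z + eval (q^ m · r) z        ≈⟨ +-cong (eval-q^ z n p) (eval-q^ z m r) ⟩
      z ^ n * eval p z + z ^ m * eval r z          ≈⟨ +-cong (*-congˡ e) (*-congˡ f) ⟩
      z ^ n * (z ^ m * v) + z ^ m * (z ^ n * w)
        ≈⟨ solve 4 (λ s t v w → t :* (s :* v) :+ s :* (t :* w) := s :* t :* (v :+ w)) refl _ _ _ _ ⟩
      z ^ m * z ^ n * (v + w)                      ≈⟨ *-congʳ (^-homo-* z m n) ⟨
      z ^ (m ℕ.+ n) * (v + w)                      ∎)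

    *-↦ : ∀ {x y v w} → x ↦ v → y ↦ w → x *ᴸ y ↦ v * w
    *-↦ {p /q^ m} {r /q^ n} {v} {w} (value e) (value f) = value (begin
      eval (p *ᵖ r) z                ≈⟨ eval-*ᵖ z p r ⟩
      eval p z * eval r z            ≈⟨ *-cong e f ⟩
      (z ^ m * v) * (z ^ n * w)
        ≈⟨ solve 4 (λ s t v w → (s :* v) :* (t :* w) := s :* t :* (v :* w)) refl _ _ _ _ ⟩
      z ^ m * z ^ n * (v * w)        ≈⟨ *-congʳ (^-homo-* z m n) ⟨
      z ^ (m ℕ.+ n) * (v * w)        ∎)

    dot-↦ : ∀ {x y x′ y′ v w v′ w′} → x ↦ v → y ↦ w → x′ ↦ v′ → y′ ↦ w′ →
      x *ᴸ y +ᴸ x′ *ᴸ y′ ↦ v * w + v′ * w′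
    dot-↦ e f e′ f′ = +-↦ (*-↦ e f) (*-↦ e′ f′)

    0-↦ : 0ᴸ ↦ 0#
    0-↦ = value (sym (zeroʳ _))

    1-↦ : 1ᴸ ↦ 1#
    1-↦ = value (begin
      (1# + 0#) + z * 0#   ≈⟨ solve 1 (λ x → con 1ℤ :+ x :* con 0ℤ := con 1ℤ) refl z ⟩
      1# + 0#              ≈⟨ +-identityʳ 1# ⟩
      1#                   ≈⟨ *-identityʳ 1# ⟨
      1# * 1#              ∎)

    q-↦ : qᴸ ↦ z
    q-↦ = value (begin
      0# + z * ((1# + 0#) + z * 0#)
        ≈⟨ solve 1 (λ x → con 0ℤ :+ x :* (con 1ℤ :+ x :* con 0ℤ) := x) refl z ⟩
      z        ≈⟨ *-identityˡ z ⟨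
      1# * z   ∎)

    -q⁻¹-↦ : -q⁻¹ ↦ - i
    -q⁻¹-↦ = value (begin
      - (1# + 0#) + z * 0#   ≈⟨ solve 1 (λ x → :- con 1ℤ :+ x :* con 0ℤ := :- con 1ℤ) refl z ⟩
      - (1# + 0#)            ≈⟨ -‿cong (+-identityʳ 1#) ⟩
      - 1#                   ≈⟨ -‿cong i*z≈1 ⟨
      - (i * z)              ≈⟨ solve 2 (λ i z → :- (i :* z) := z :* :- i) refl i z ⟩
      z * - i                ≈⟨ *-congʳ (*-identityʳ z) ⟨
      (z * 1#) * - i         ∎)

    -- Carries values of matrix entries over to polynomials known only through `Represents`: both
    -- sides agree after multiplication by z^m, and z^m is invertible.
    eval-representative : ∀ {p x v} → p Represents x → x ↦ v → eval p z ≈ v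
    eval-representative {p} {n /q^ m} {v} rep (value e) = z^-cancelˡ m (begin
      z ^ m * eval p z      ≈⟨ eval-q^ z m p ⟨
      eval (q^ m · p) z     ≈⟨ eval-≋ z n (q^ m · p) rep ⟨
      eval n z              ≈⟨ e ⟩
      z ^ m * v             ∎)

    zpow-neg : ∀ n → zpow z z-unit (ℤ.- + n) ≈ i ^ n
    zpow-neg zero    = refl
    zpow-neg (suc n) = refl

    zpow-⊖ : ∀ m n → zpow z z-unit (m ℤ.⊖ n) ≈ z ^ m * i ^ n
    zpow-⊖ m       zero    = sym (*-identityʳ _)
    zpow-⊖ zero    (suc n) = sym (*-identityˡ _)
    zpow-⊖ (suc m) (suc n) = begin
      zpow z z-unit (suc m ℤ.⊖ suc n)  ≡⟨ ≡.cong (zpow z z-unit) (ℤ.[1+m]⊖[1+n]≡m⊖n m n) ⟩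
      zpow z z-unit (m ℤ.⊖ n)          ≈⟨ zpow-⊖ m n ⟩
      z ^ m * i ^ n                    ≈⟨ *-identityˡ _ ⟨
      1# * (z ^ m * i ^ n)             ≈⟨ *-congʳ i*z≈1 ⟨
      i * z * (z ^ m * i ^ n)
        ≈⟨ solve 4 (λ i z s t → i :* z :* (s :* t) := z :* s :* (i :* t)) refl _ _ _ _ ⟩
      z ^ suc m * i ^ suc n            ∎

    zpow-- : ∀ m n → zpow z z-unit (+ m ℤ.- + n) ≈ z ^ m * i ^ n
    zpow-- m n = trans (reflexive (≡.cong (zpow z z-unit) (ℤ.[+m]-[+n]≡m⊖n m n))) (zpow-⊖ m n)

    zpow--1 : ∀ m n → zpow z z-unit (+ m ℤ.- + n ℤ.- 1ℤ) ≈ z ^ m * i ^ suc n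
    zpow--1 m n = trans (reflexive (≡.cong (zpow z z-unit) merge)) (zpow-- m (suc n))
      where
      -- The last -1 raises the subtracted exponent to `suc n`, the form that `zpow--` accepts.
      merge : + m ℤ.- + n ℤ.- 1ℤ ≡ + m ℤ.- + suc n
      merge = ≡.trans (ℤ.+-assoc (+ m) (ℤ.- + n) -1ℤ) (≡.cong (λ l → + m ℤ.+ l)
        (≡.trans (≡.sym (ℤ.neg-distrib-+ (+ n) 1ℤ)) (≡.cong (λ l → ℤ.- + l) (ℕ.+-comm n 1))))

    -- σ is kept apart from - 1# because at ℂ two convertible but not syntactically equal
    -- expressions can be compared only by unfolding the Cauchy proofs inside them.
    module SixthRoot (z²+1≈z : z * z + 1# ≈ z) (σ : Carrier) (σ≈-1 : σ ≈ - 1#) where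

      -- Inverse powers and matrices when z² - z + 1 = 0.

      open import Algebra.Properties.Monoid.Sum +-monoid using (sum-syntax; sum⁺-syntax; sum-cong-≋)
      open import Algebra.Properties.Semiring.Sum semiring using (*-distribˡ-sum)

      -- Multiplying z² + 1 = z by `i` gives i = 1 - z, whence i² = i - 1 = -z.
      i*i≈-z : i * i ≈ - z
      i*i≈-z = begin
        i * i              ≈⟨ *-congˡ i≈1-z ⟩
        i * (1# - z)       ≈⟨ solve 3 (λ i o z → i :* (o :- z) := i :* o :- i :* z) refl i 1# z ⟩
        i * 1# - i * z     ≈⟨ +-cong (trans (*-identityʳ i) i≈1-z) (-‿cong i*z≈1) ⟩
        (1# - z) - 1#      ≈⟨ solve 2 (λ o z → (o :- z) :- o := :- z) refl 1# z ⟩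
        - z                ∎
        where
        i≈1-z : i ≈ 1# - z
        i≈1-z = begin
          i                                ≈⟨ *-identityʳ i ⟨
          i * 1#
            ≈⟨ solve 3 (λ i o z → i :* o := i :* (z :* z :+ o) :- i :* z :* z) refl i 1# z ⟩
          i * (z * z + 1#) - i * z * z     ≈⟨ +-cong (*-congˡ z²+1≈z) (-‿cong (*-congʳ i*z≈1)) ⟩
          i * z - 1# * z                   ≈⟨ +-cong i*z≈1 (-‿cong (*-identityˡ z)) ⟩
          1# - z                           ∎

      i*i*i≈-1 : i * i * i ≈ - 1#
      i*i*i≈-1 = begin
        i * i * i    ≈⟨ *-congʳ i*i≈-z ⟩
        - z * i      ≈⟨ solve 2 (λ i z → :- z :* i := :- (i :* z)) refl i z ⟩
        - (i * z)    ≈⟨ -‿cong i*z≈1 ⟩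
        - 1#         ∎

      -- The entry `v₁₂` is the q-integer 1 + z + ... + z^(c-1). It equals (1 - z^c)/(1 - z), and
      -- 1/(1 - z) = z because z (1 - z) = 1.
      record R^-Values (c : ℕ) : Set ℓ where
        field
          v₁₁ : m₁₁ (Rq^ c) ↦ z ^ c
          v₁₂ : m₁₂ (Rq^ c) ↦ z - z * z ^ c
          v₂₁ : m₂₁ (Rq^ c) ↦ 0#
          v₂₂ : m₂₂ (Rq^ c) ↦ 1#

      R^-values : ∀ c → R^-Values c
      R^-values zero    = record
        { v₁₁ = 1-↦
        ; v₁₂ = ↦-cong (sym (trans (+-congˡ (-‿cong (*-identityʳ z))) (-‿inverseʳ z))) 0-↦
        ; v₂₁ = 0-↦
        ; v₂₂ = 1-↦
        }
      R^-values (suc c) = record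
        { v₁₁ = ↦-cong (trans (+-congˡ (zeroʳ 1#)) (+-identityʳ _)) (dot-↦ q-↦ v₁₁ 1-↦ v₂₁)
        ; v₁₂ = ↦-cong (begin
            z * (z - z * z ^ c) + 1# * 1#
              ≈⟨ +-congˡ (*-identityˡ 1#) ⟩
            z * (z - z * z ^ c) + 1#
              ≈⟨ solve 3 (λ z w o → z :* (z :- z :* w) :+ o := (z :* z :+ o) :- z :* (z :* w)) refl _ _ _ ⟩
            (z * z + 1#) - z * (z * z ^ c)
              ≈⟨ +-congʳ z²+1≈z ⟩
            z - z * z ^ suc c ∎) (dot-↦ q-↦ v₁₂ 1-↦ v₂₂)
        ; v₂₁ = ↦-cong (trans (+-cong (zeroˡ _) (zeroʳ _)) (+-identityˡ 0#)) (dot-↦ 0-↦ v₁₁ 1-↦ v₂₁)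
        ; v₂₂ = ↦-cong (trans (+-cong (zeroˡ _) (*-identityˡ 1#)) (+-identityˡ 1#)) (dot-↦ 0-↦ v₁₂ 1-↦ v₂₂)
        }
        where open R^-Values (R^-values c)

      -- The rows of R^c S at z are (z - z^(c+1), -z^c i) and (1, 0).
      column-step : ∀ c {A x y} → m₁₁ A ↦ x → m₂₁ A ↦ y →
        (m₁₁ (Rq^ c *ᴹ Sq *ᴹ A) ↦ (z - z * z ^ c) * x - z ^ c * (i * y)) × (m₂₁ (Rq^ c *ᴹ Sq *ᴹ A) ↦ x)
      column-step c {A} {x} {y} xₐ yₐ =
          ↦-cong (begin
            (z ^ c * 0# + (z - z * z ^ c) * 1#) * x + (z ^ c * - i + (z - z * z ^ c) * 0#) * y
              ≈⟨ +-congʳ (*-congʳ (+-congˡ (*-identityʳ _))) ⟩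
            (z ^ c * 0# + (z - z * z ^ c)) * x + (z ^ c * - i + (z - z * z ^ c) * 0#) * y
              ≈⟨ solve 5 (λ z w i x y →
                   (w :* con 0ℤ :+ (z :- z :* w)) :* x :+ (w :* :- i :+ (z :- z :* w) :* con 0ℤ) :* y :=
                   (z :- z :* w) :* x :- w :* (i :* y)) refl _ _ _ _ _ ⟩
            (z - z * z ^ c) * x - z ^ c * (i * y) ∎)
            (dot-↦ (dot-↦ v₁₁ 0-↦ v₁₂ 1-↦) xₐ (dot-↦ v₁₁ -q⁻¹-↦ v₁₂ 0-↦) yₐ)
        , ↦-cong (begin
            (0# * 0# + 1# * 1#) * x + (0# * - i + 1# * 0#) * y
              ≈⟨ +-congʳ (*-congʳ (+-congˡ (*-identityʳ _))) ⟩
            (0# * 0# + 1#) * x + (0# * - i + 1# * 0#) * y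
              ≈⟨ solve 4 (λ i o x y →
                   (con 0ℤ :* con 0ℤ :+ o) :* x :+ (con 0ℤ :* :- i :+ o :* con 0ℤ) :* y := o :* x) refl _ _ _ _ ⟩
            1# * x ≈⟨ *-identityˡ x ⟩
            x ∎)
            (dot-↦ (dot-↦ v₂₁ 0-↦ v₂₂ 1-↦) xₐ (dot-↦ v₂₁ -q⁻¹-↦ v₂₂ 0-↦) yₐ)
        where open R^-Values (R^-values c)

      -- The closed formulas and their recursion.

      partialSum : ∀ {k} → Vec ℕ k → ℕ → ℕ
      partialSum cs j = sum (take j (toList cs))

      term : ∀ {k} → Vec ℕ k → ℕ → Carrier
      term cs j = σ ^ j * zpow z z-unit (ℤ.- + partialSum cs j)

      tailSum fullSum : ∀ {k} → Vec ℕ k → Carrier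
      tailSum {k} cs = ∑[ j < k ] term cs (suc (toℕ j))
      fullSum {k} cs = ∑[ j ≤ k ] term cs (toℕ j)

      -- Prepending `c` adds `c` to every later partial sum, and the index shift contributes one
      -- factor -1.
      term-suc : ∀ {k} c (cs : Vec ℕ k) j → term (c ∷ cs) (suc j) ≈ - (i ^ c) * term cs j
      term-suc c cs j = begin
        σ * σ ^ j * zpow z z-unit (ℤ.- + (c ℕ.+ s))
          ≈⟨ *-cong (*-congʳ σ≈-1) (trans (zpow-neg (c ℕ.+ s)) (^-homo-* i c s)) ⟩
        - 1# * σ ^ j * (i ^ c * i ^ s)
          ≈⟨ *-congʳ (-1*x≈-x _) ⟩
        - (σ ^ j) * (i ^ c * i ^ s)
          ≈⟨ solve 3 (λ n u v → :- n :* (u :* v) := :- u :* (n :* v)) refl _ _ _ ⟩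
        - (i ^ c) * (σ ^ j * i ^ s)
          ≈⟨ *-congˡ (*-congˡ (zpow-neg s)) ⟨
        - (i ^ c) * term cs j ∎
        where s = partialSum cs j

      fullSum≈1+tailSum : ∀ {k} (cs : Vec ℕ k) → fullSum cs ≈ 1# + tailSum cs
      fullSum≈1+tailSum cs = +-congʳ (*-identityˡ 1#)

      -- The tail of the longer vector has an index range as long as the full sum of the shorter
      -- one; `term-suc` matches them term by term.
      tailSum-∷ : ∀ {k} c (cs : Vec ℕ k) → tailSum (c ∷ cs) ≈ - (i ^ c) * fullSum cs
      tailSum-∷ {k} c cs = trans
        (sum-cong-≋ {n = suc k} (λ j → term-suc c cs (toℕ j)))
        (sym (*-distribˡ-sum {n = suc k} (- (i ^ c)) (λ j → term cs (toℕ j))))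

      -- This is z^(C_k - 2k), with the two signs of exponent kept apart so that the induction uses
      -- natural exponents only.
      weight : ∀ {k} → Vec ℕ k → Carrier
      weight {k} cs = z ^ partialSum cs k * i ^ (2 ℕ.* k)

      weight-∷ : ∀ {k} c (cs : Vec ℕ k) → weight (c ∷ cs) ≈ z ^ c * (i * i * weight cs)
      weight-∷ {k} c cs = begin
        z ^ (c ℕ.+ s) * i ^ (2 ℕ.* suc k)
          ≡⟨ ≡.cong (λ l → z ^ (c ℕ.+ s) * i ^ l) (ℕ.*-suc 2 k) ⟩
        z ^ (c ℕ.+ s) * (i * (i * i ^ (2 ℕ.* k)))
          ≈⟨ *-congʳ (^-homo-* z c s) ⟩
        z ^ c * z ^ s * (i * (i * i ^ (2 ℕ.* k)))
          ≈⟨ solve 4 (λ u v i w → u :* v :* (i :* (i :* w)) := u :* (i :* i :* (v :* w))) refl _ _ _ _ ⟩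
        z ^ c * (i * i * weight cs) ∎
        where s = partialSum cs k

      upper lower : ∀ {k} → Vec ℕ k → Carrier
      upper cs = weight cs * fullSum cs
      lower cs = weight cs * i * tailSum cs

      -- The weight brings z^c i², the extra factor makes it i³ = -1, and both this sign and z^c
      -- cancel against -i^c from `tailSum-∷`.
      lower-∷ : ∀ {k} c (cs : Vec ℕ k) → lower (c ∷ cs) ≈ upper cs
      lower-∷ c cs = begin
        weight (c ∷ cs) * i * tailSum (c ∷ cs)
          ≈⟨ *-cong (*-congʳ (weight-∷ c cs)) (tailSum-∷ c cs) ⟩
        z ^ c * (i * i * weight cs) * i * (- (i ^ c) * fullSum cs)
          ≈⟨ solve 5 (λ w i W I S → w :* (i :* i :* W) :* i :* (:- I :* S) :=
               :- (i :* i :* i) :* (I :* w) :* (W :* S)) refl _ _ _ _ _ ⟩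
        - (i * i * i) * (i ^ c * z ^ c) * upper cs
          ≈⟨ *-congʳ (*-cong (-‿cong i*i*i≈-1) (i^*z^ c)) ⟩
        - (- 1#) * 1# * upper cs
          ≈⟨ solve 2 (λ o x → :- :- o :* o :* x := o :* (o :* x)) refl 1# _ ⟩
        1# * (1# * upper cs)
          ≈⟨ trans (*-identityˡ _) (*-identityˡ _) ⟩
        upper cs ∎

      -- With i² = -z and z^c i^c = 1, both sides reduce to z W S - z^(c+1) W, where W and S are the
      -- weight and full sum of `cs`.
      upper-∷ : ∀ {k} c (cs : Vec ℕ k) →
        upper (c ∷ cs) ≈ (z - z * z ^ c) * upper cs - z ^ c * (i * lower cs)
      upper-∷ c cs = begin
        weight (c ∷ cs) * fullSum (c ∷ cs)
          ≈⟨ *-cong (weight-∷ c cs) (trans (fullSum≈1+tailSum (c ∷ cs)) (+-congˡ (tailSum-∷ c cs))) ⟩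
        w * (i * i * W) * (1# + - (i ^ c) * S)
          ≈⟨ *-congʳ (*-congˡ (*-congʳ i*i≈-z)) ⟩
        w * (- z * W) * (1# + - (i ^ c) * S)
          ≈⟨ solve 6 (λ w z W o I S → w :* (:- z :* W) :* (o :+ :- I :* S) :=
               (I :* w) :* (z :* W :* S) :- o :* (w :* (z :* W))) refl _ _ _ _ _ _ ⟩
        i ^ c * w * (z * W * S) - 1# * (w * (z * W))
          ≈⟨ +-congʳ (trans (*-congʳ (i^*z^ c)) (*-identityˡ _)) ⟩
        z * W * S - 1# * (w * (z * W))
          -- Adds and subtracts z w W t, where t is the tail sum: one copy completes 1 + t to S, the
          -- other becomes the `lower` term.
          ≈⟨ solve 6 (λ w z W o S t → z :* W :* S :- o :* (w :* (z :* W)) :=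
               (z :* W :* S :- z :* w :* W :* (o :+ t)) :- w :* (:- z :* (W :* t))) refl _ _ _ _ _ (tailSum cs) ⟩
        (z * W * S - z * w * W * (1# + tailSum cs)) - w * (- z * (W * tailSum cs))
          ≈⟨ +-cong (+-congˡ (-‿cong (*-congˡ (fullSum≈1+tailSum cs)))) (-‿cong (*-congˡ (*-congʳ i*i≈-z))) ⟨
        (z * W * S - z * w * W * S) - w * (i * i * (W * tailSum cs))
          ≈⟨ solve 6 (λ w z W S i t → (z :* W :* S :- z :* w :* W :* S) :- w :* (i :* i :* (W :* t)) :=
               (z :- z :* w) :* (W :* S) :- w :* (i :* (W :* i :* t))) refl _ _ _ _ _ _ ⟩
        (z - z * w) * upper cs - w * (i * lower cs) ∎
        where
        w = z ^ c
        W = weight cs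
        S = fullSum cs

      -- The induction starts at the empty product, whose column (1, 0) fits the formulas: weight
      -- and full sum are 1, the tail sum is empty.
      column-values : ∀ {k} (cs : Vec ℕ k) → (m₁₁ (Mq cs) ↦ upper cs) × (m₂₁ (Mq cs) ↦ lower cs)
      column-values []       =
          ↦-cong (sym (trans
            (*-cong (*-identityˡ 1#) (trans (+-identityʳ _) (*-identityˡ 1#)))
            (*-identityˡ 1#))) 1-↦
        , ↦-cong (sym (zeroʳ _)) 0-↦
      column-values (c ∷ cs) =
        let (x , y) = column-values cs
            (x′ , y′) = column-step c {Mq cs} x y
        in ↦-cong (sym (upper-∷ c cs)) x′ , ↦-cong (sym (lower-∷ c cs)) y′

      -- The summand g is left to unification: it is then never compared with another
      -- function into ℂ, which would unfold Cauchy proofs (see σ above).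
      eval-upper : ∀ {n} (cs : Vec ℕ (suc n)) {p} → p Represents m₁₁ (Mq cs) →
        {g : Fin n → Carrier} → (∀ j → g j ≈ term cs (2 ℕ.+ toℕ j)) →
        eval p z ≈ zpow z z-unit (+ partialSum cs (suc n) ℤ.- + (2 ℕ.* suc n)) *
          (term cs 0 + (term cs 1 + ∑[ j < n ] g j))
      eval-upper {n} cs {p} rep g≈ = begin
        eval p z
          ≈⟨ eval-representative {p} {m₁₁ (Mq cs)} rep (proj₁ (column-values cs)) ⟩
        weight cs * fullSum cs
          ≈⟨ *-cong (zpow-- (partialSum cs (suc n)) (2 ℕ.* suc n)) (+-congˡ (+-congˡ (sum-cong-≋ g≈))) ⟨
        _ ∎

      eval-lower : ∀ {n} (cs : Vec ℕ (suc n)) {p} → p Represents m₂₁ (Mq cs) →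
        {g : Fin n → Carrier} → (∀ j → g j ≈ term cs (2 ℕ.+ toℕ j)) →
        eval p z ≈ zpow z z-unit (+ partialSum cs (suc n) ℤ.- + (2 ℕ.* suc n) ℤ.- 1ℤ) *
          (term cs 1 + ∑[ j < n ] g j)
      eval-lower {n} cs {p} rep g≈ = begin
        eval p z
          ≈⟨ eval-representative {p} {m₂₁ (Mq cs)} rep (proj₂ (column-values cs)) ⟩
        z ^ C * i ^ (2 ℕ.* suc n) * i * tailSum cs
          -- The separate factor `i` joins the inverse power; it accounts for the -1 in the
          -- exponent.
          ≈⟨ *-congʳ (trans (*-assoc _ _ _) (*-congˡ (*-comm _ _))) ⟩
        z ^ C * i ^ suc (2 ℕ.* suc n) * tailSum cs
          ≈⟨ *-cong (zpow--1 C (2 ℕ.* suc n)) (+-congˡ (sum-cong-≋ g≈)) ⟨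
        _ ∎
        where C = partialSum cs (suc n)

-- Primitive sixth roots of unity in a ring without zero divisors.

module _ {a ℓ} (R : CommutativeRing a ℓ) where
  open CommutativeRing R hiding (zero)
  open RingNotions R using (IsPrimitiveRoot)
  open Evaluation R
  open import Algebra.Properties.Group +-group using ()
    renaming (x∙y⁻¹≈ε⇒x≈y to x-y≈0⇒x≈y; x≈y⇒x∙y⁻¹≈ε to x≈y⇒x-y≈0)
  open import Algebra.Properties.Semiring.Exp semiring using (_^_)
  open import Relation.Binary.Reasoning.Setoid setoid

  -- An implication, since the disjunctive form would ask to decide which factor vanishes, which
  -- Cauchy sequences do not permit.
  NoZeroDivisors : Set _
  NoZeroDivisors = ∀ x y → ¬ (x ≈ 0#) → x * y ≈ 0# → y ≈ 0#

  square≈1⇒≈-1 : NoZeroDivisors → ∀ x → ¬ (x ≈ 1#) → x * x ≈ 1# → x + 1# ≈ 0#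
  square≈1⇒≈-1 noZeroDivisors x x≉1 x²≈1 =
    noZeroDivisors (x - 1#) (x + 1#) (λ e → x≉1 (x-y≈0⇒x≈y x 1# e)) (begin
      (x - 1#) * (x + 1#)   ≈⟨ solve 2 (λ x o → (x :- o) :* (x :+ o) := x :* x :- o :* o) refl x 1# ⟩
      x * x - 1# * 1#       ≈⟨ x≈y⇒x-y≈0 (trans x²≈1 (sym (*-identityˡ 1#))) ⟩
      0#                    ∎)

  -- ζ⁶ - 1 = (ζ³ - 1)(ζ + 1)(ζ² - ζ + 1).
  primitiveSixthRoot⇒ζ²+1≈ζ : NoZeroDivisors → ∀ {ζ} → IsPrimitiveRoot 6 ζ → ζ * ζ + 1# ≈ ζ
  primitiveSixthRoot⇒ζ²+1≈ζ noZeroDivisors {ζ} (ζ⁶≈1 , ζᵐ≉1) =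
    x-y≈0⇒x≈y (ζ * ζ + 1#) ζ (noZeroDivisors (ζ + 1#) _ ζ+1≉0 (begin
      (ζ + 1#) * (ζ * ζ + 1# - ζ)
        ≈⟨ *-congˡ (+-cong (+-congˡ (*-identityˡ 1#)) (-‿cong (*-identityˡ ζ))) ⟨
      (ζ + 1#) * (ζ * ζ + 1# * 1# - 1# * ζ)
        ≈⟨ solve 2 (λ z o → (z :+ o) :* (z :* z :+ o :* o :- o :* z) :=
             z :* (z :* z) :+ o :* o :* o) refl ζ 1# ⟩
      ζ * (ζ * ζ) + 1# * 1# * 1#
        ≈⟨ +-cong (*-congˡ (*-congˡ (sym (*-identityʳ ζ)))) (trans (*-identityʳ _) (*-identityˡ 1#)) ⟩
      ζ ^ 3 + 1#
        -- ζ³ squares to 1 and differs from 1 by primitivity, so it is -1.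
        ≈⟨ square≈1⇒≈-1 noZeroDivisors (ζ ^ 3) (ζᵐ≉1 3 ℕ.z<s (ℕ.m<m+n 3 ℕ.z<s))
             (trans (solve 2 (λ z o → (z :* (z :* (z :* o))) :* (z :* (z :* (z :* o))) :=
                       (z :* (z :* (z :* (z :* (z :* (z :* o)))))) :* o) refl ζ 1#)
                    (trans (*-identityʳ _) ζ⁶≈1)) ⟩
      0# ∎))
    where
    ζ+1≉0 : ¬ (ζ + 1# ≈ 0#)
    -- ζ = -1 would give ζ² = 1.
    ζ+1≉0 ζ+1≈0 = ζᵐ≉1 2 ℕ.z<s (ℕ.m<m+n 2 ℕ.z<s) (x-y≈0⇒x≈y (ζ ^ 2) 1# (begin
      ζ * (ζ * 1#) - 1#       ≈⟨ +-cong (*-congˡ (*-identityʳ ζ)) (-‿cong (sym (*-identityˡ 1#))) ⟩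
      ζ * ζ - 1# * 1#         ≈⟨ solve 2 (λ z o → z :* z :- o :* o := (z :+ o) :* (z :- o)) refl ζ 1# ⟩
      (ζ + 1#) * (ζ - 1#)     ≈⟨ *-congʳ ζ+1≈0 ⟩
      0# * (ζ - 1#)           ≈⟨ zeroˡ _ ⟩
      0#                      ∎))

-- Absence of zero divisors in ℝ and ℂ.

module ℂᵣ = CommutativeRing ℂ-commutativeRing

module _ where
  open import Data.Rational.Base using (0ℚ; ∣_∣; _+_; _*_; -_; _-_; _<_; _≤_)
  open ℚ-Solver.+-*-Solver

  0ʳ : ℝ
  0ʳ = constʳ 0ℚ

  <⇒≱ : ∀ {p q} → p < q → ¬ (q ≤ p)
  <⇒≱ p<q q≤p = ℚₚ.<-irrefl ≡.refl (ℚₚ.<-≤-trans p<q q≤p)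

  ∣p-0∣≡∣p∣ : ∀ p → ∣ p - 0ℚ ∣ ≡ ∣ p ∣
  ∣p-0∣≡∣p∣ p = ≡.cong ∣_∣ (ℚₚ.+-identityʳ p)

  0<p*q : ∀ {p q} → 0ℚ < p → 0ℚ < q → 0ℚ < p * q
  0<p*q {p} {q} 0<p 0<q =
    ℚₚ.positive⁻¹ (p * q) {{ℚₚ.pos*pos⇒pos p {{ℚ.positive 0<p}} q {{ℚ.positive 0<q}}}}

  ∣p∣≤∣p-q∣+∣q∣ : ∀ p q → ∣ p ∣ ≤ ∣ p - q ∣ + ∣ q ∣
  ∣p∣≤∣p-q∣+∣q∣ p q = begin
    ∣ p ∣               ≡⟨ ≡.cong ∣_∣ (solve 2 (λ p q → p := (p :- q) :+ q) ≡.refl p q) ⟩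
    ∣ (p - q) + q ∣     ≤⟨ ℚₚ.∣p+q∣≤∣p∣+∣q∣ (p - q) q ⟩
    ∣ p - q ∣ + ∣ q ∣   ∎
    where open ℚₚ.≤-Reasoning

  -- With δ = ε/3, the sequence of y is eventually either below ε or above δ in
  -- absolute value, according to one sufficiently late term; in the second case x ≈ 0.
  ℝ-noZeroDivisors : ∀ x y → ¬ (x ≈ʳ 0ʳ) → x *ʳ y ≈ʳ 0ʳ → y ≈ʳ 0ʳ
  -- The test concerns a single rational and is therefore decidable. Later terms differ from it by
  -- less than δ.
  ℝ-noZeroDivisors x y x≉0 xy≈0 ε 0<ε = dichotomy (∣ seq y N ∣ ℚₚ.<? δ + δ)
    where
    ⅓ = 1ℤ ℚ./ 3
    δ = ⅓ * ε

    0<δ : 0ℚ < δ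
    0<δ = 0<p*q (ℚₚ.positive⁻¹ ⅓) 0<ε

    3δ≡ε : δ + (δ + δ) ≡ ε
    3δ≡ε = solve 1 (λ ε → con ⅓ :* ε :+ (con ⅓ :* ε :+ con ⅓ :* ε) := ε) ≡.refl ε

    N = proj₁ (cauchy y δ 0<δ)
    close = proj₂ (cauchy y δ 0<δ)

    dichotomy : Dec (∣ seq y N ∣ < δ + δ) → ∃ λ N → ∀ n → N ℕ.≤ n → ∣ seq y n - 0ℚ ∣ < ε
    dichotomy (yes small) = N , λ n N≤n → begin-strict
      ∣ seq y n - 0ℚ ∣                     ≡⟨ ∣p-0∣≡∣p∣ (seq y n) ⟩
      ∣ seq y n ∣                          ≤⟨ ∣p∣≤∣p-q∣+∣q∣ (seq y n) (seq y N) ⟩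
      ∣ seq y n - seq y N ∣ + ∣ seq y N ∣  <⟨ ℚₚ.+-mono-< (close n N N≤n ℕ.≤-refl) small ⟩
      δ + (δ + δ)                          ≡⟨ 3δ≡ε ⟩
      ε                                    ∎
      where open ℚₚ.≤-Reasoning
    dichotomy (no large) = contradiction x≈0 x≉0
      where
      open ℚₚ.≤-Reasoning

      δ<∣y∣ : ∀ n → N ℕ.≤ n → δ < ∣ seq y n ∣
      δ<∣y∣ n N≤n = ℚₚ.≰⇒> λ ∣y∣≤δ → <⇒≱ (begin-strict
        ∣ seq y N ∣                          ≤⟨ ∣p∣≤∣p-q∣+∣q∣ (seq y N) (seq y n) ⟩
        ∣ seq y N - seq y n ∣ + ∣ seq y n ∣  <⟨ ℚₚ.+-mono-<-≤ (close N n ℕ.≤-refl N≤n) ∣y∣≤δ ⟩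
        δ + δ                                ∎) (ℚₚ.≮⇒≥ large)

      x≈0 : x ≈ʳ 0ʳ
      x≈0 ε′ 0<ε′ =
        -- Dividing the bound ε′ δ by |y_n| > δ leaves less than ε′.
        let (M , xy-small) = xy≈0 (ε′ * δ) (0<p*q 0<ε′ 0<δ)
        in N ℕ.⊔ M , λ n N⊔M≤n →
          ℚₚ.*-cancelʳ-<-nonNeg ∣ seq y n ∣ {{ℚₚ.∣-∣-nonNeg (seq y n)}} (begin-strict
            ∣ seq x n - 0ℚ ∣ * ∣ seq y n ∣  ≡⟨ ≡.cong (_* ∣ seq y n ∣) (∣p-0∣≡∣p∣ (seq x n)) ⟩
            ∣ seq x n ∣ * ∣ seq y n ∣       ≡⟨ ℚₚ.∣p*q∣≡∣p∣*∣q∣ (seq x n) (seq y n) ⟨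
            ∣ seq x n * seq y n ∣           ≡⟨ ∣p-0∣≡∣p∣ (seq x n * seq y n) ⟨
            ∣ seq x n * seq y n - 0ℚ ∣      <⟨ xy-small n (ℕ.m⊔n≤o⇒n≤o N M N⊔M≤n) ⟩
            ε′ * δ
              ≤⟨ ℚₚ.*-monoˡ-≤-nonNeg ε′ {{ℚₚ.pos⇒nonNeg ε′ {{ℚ.positive 0<ε′}}}}
                   (ℚₚ.<⇒≤ (δ<∣y∣ n (ℕ.m⊔n≤o⇒m≤o N M N⊔M≤n))) ⟩
            ε′ * ∣ seq y n ∣                ∎)

  p*p≡∣p∣*∣p∣ : ∀ p → p * p ≡ ∣ p ∣ * ∣ p ∣
  p*p≡∣p∣*∣p∣ p with ℚₚ.∣p∣≡p∨∣p∣≡-p p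
  ... | inj₁ e = ≡.sym (≡.cong₂ _*_ e e)
  ... | inj₂ e = ≡.trans
    (solve 1 (λ p → p :* p := (:- p) :* (:- p)) ≡.refl p) (≡.sym (≡.cong₂ _*_ e e))

  0≤p*p : ∀ p → 0ℚ ≤ p * p
  0≤p*p p = ≡.subst (0ℚ ≤_)
    (≡.trans (ℚₚ.∣p*q∣≡∣p∣*∣q∣ p p) (≡.sym (p*p≡∣p∣*∣p∣ p))) (ℚₚ.0≤∣p∣ (p * p))

  p*p<q*q⇒∣p∣<q : ∀ p q → 0ℚ < q → p * p < q * q → ∣ p ∣ < q
  p*p<q*q⇒∣p∣<q p q 0<q p²<q² = ℚₚ.≰⇒> λ q≤∣p∣ → <⇒≱ p²<q² (begin
    q * q           ≤⟨ ℚₚ.*-monoˡ-≤-nonNeg q {{ℚₚ.pos⇒nonNeg q {{ℚ.positive 0<q}}}} q≤∣p∣ ⟩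
    q * ∣ p ∣       ≤⟨ ℚₚ.*-monoʳ-≤-nonNeg ∣ p ∣ {{ℚₚ.∣-∣-nonNeg p}} q≤∣p∣ ⟩
    ∣ p ∣ * ∣ p ∣   ≡⟨ p*p≡∣p∣*∣p∣ p ⟨
    p * p           ∎)
    where open ℚₚ.≤-Reasoning

  -- Termwise x² ≤ x² + y², so tolerance ε² for the sum gives ε for x.
  x²+y²≈0⇒x≈0 : ∀ x y → x *ʳ x +ʳ y *ʳ y ≈ʳ 0ʳ → x ≈ʳ 0ʳ
  x²+y²≈0⇒x≈0 x y sum≈0 ε 0<ε =
    let (N , small) = sum≈0 (ε * ε) (0<p*q 0<ε 0<ε)
    in N , λ n N≤n → begin-strict
      ∣ seq x n - 0ℚ ∣   ≡⟨ ∣p-0∣≡∣p∣ (seq x n) ⟩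
      ∣ seq x n ∣        <⟨ p*p<q*q⇒∣p∣<q (seq x n) ε 0<ε (square< (seq x n) (seq y n) (small n N≤n)) ⟩
      ε                  ∎
    where
    open ℚₚ.≤-Reasoning
    square< : ∀ p q {r} → ∣ p * p + q * q - 0ℚ ∣ < r → p * p < r
    square< p q {r} lt = begin-strict
      p * p                        ≡⟨ ℚₚ.+-identityʳ (p * p) ⟨
      p * p + 0ℚ                   ≤⟨ ℚₚ.+-monoʳ-≤ (p * p) (0≤p*p q) ⟩
      p * p + q * q                ≡⟨ ℚₚ.0≤p⇒∣p∣≡p (ℚₚ.+-mono-≤ (0≤p*p p) (0≤p*p q)) ⟨
      ∣ p * p + q * q ∣            ≡⟨ ∣p-0∣≡∣p∣ (p * p + q * q) ⟨
      ∣ p * p + q * q - 0ℚ ∣       <⟨ lt ⟩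
      r                            ∎

  -- Multiplying z w ≈ 0 by the conjugate of z reduces the claim to the real number |z|².
  ℂ-noZeroDivisors : NoZeroDivisors ℂ-commutativeRing
  ℂ-noZeroDivisors z@(a +i b) w@(c +i d) z≉0 zw≈0 =
      ℝ-noZeroDivisors ∣z∣² c ∣z∣²≉0
        (≈ʳ-trans {∣z∣² *ʳ c} {re z̄zw} {0ʳ} (pointwise⇒≈ʳ (∣z∣² *ʳ c) (re z̄zw) λ n →
          solve 4 (λ a b c d → (a :* a :+ b :* b) :* c :=
            a :* (a :* c :+ :- (b :* d)) :+ :- ((:- b) :* (a :* d :+ b :* c))) ≡.refl
            (seq a n) (seq b n) (seq c n) (seq d n)) (proj₁ z̄zw≈0))
    , ℝ-noZeroDivisors ∣z∣² d ∣z∣²≉0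
        (≈ʳ-trans {∣z∣² *ʳ d} {im z̄zw} {0ʳ} (pointwise⇒≈ʳ (∣z∣² *ʳ d) (im z̄zw) λ n →
          solve 4 (λ a b c d → (a :* a :+ b :* b) :* d :=
            a :* (a :* d :+ b :* c) :+ (:- b) :* (a :* c :+ :- (b :* d))) ≡.refl
            (seq a n) (seq b n) (seq c n) (seq d n)) (proj₂ z̄zw≈0))
    where
    z̄ = a +i (-ʳ b)
    ∣z∣² = a *ʳ a +ʳ b *ʳ b

    z̄zw = z̄ *ᶜ (z *ᶜ w)

    z̄zw≈0 : z̄zw ≈ᶜ 0ᶜ
    z̄zw≈0 = ℂᵣ.trans {z̄zw} {z̄ *ᶜ 0ᶜ} {0ᶜ} (ℂᵣ.*-congˡ {z̄} {z *ᶜ w} {0ᶜ} zw≈0) (ℂᵣ.zeroʳ z̄)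

    ∣z∣²≉0 : ¬ (∣z∣² ≈ʳ 0ʳ)
    -- Both parts of z would vanish; the imaginary one follows by exchanging a and b.
    ∣z∣²≉0 ∣z∣²≈0 = z≉0 (x²+y²≈0⇒x≈0 a b ∣z∣²≈0
      , x²+y²≈0⇒x≈0 b a (≈ʳ-trans {b *ʳ b +ʳ a *ʳ a} {∣z∣²} {0ʳ}
          (pointwise⇒≈ʳ (b *ʳ b +ʳ a *ʳ a) ∣z∣² λ n →
            ℚₚ.+-comm (seq b n * seq b n) (seq a n * seq a n)) ∣z∣²≈0))

-- The two formulas over ℂ.

open CommutativeRing ℂ-commutativeRing using (_≈_; _*_; -_; 1#; semiring; +-monoid)
open import Algebra.Properties.Semiring.Exp semiring using (_^_)
open import Algebra.Properties.Monoid.Sum +-monoid using (sum-syntax; sum⁺-syntax)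
open RingNotions ℂ-commutativeRing using (eval; IsPrimitiveRoot; root-isUnit; zpow)

theorem1p5 :
  (ζ : ℂ) (ζ-primitive : IsPrimitiveRoot 6 ζ)
  (r s : ℕ) .{{s≢0 : NonZero s}} → Coprime r s → s ℕ.< r →
  (expansion : HJExpansion (+ r ℚ./ s)) →
  let open HJExpansion expansion
      ζ^_ : ℤ → ℂ
      ζ^ e = zpow ζ (root-isUnit ζ-primitive) e
  in
  (eval 𝓡 ζ ≈
    ζ^ (+ C k ℤ.- + (2 ℕ.* k)) * (∑[ i ≤ k ] ((- 1#) ^ toℕ i * ζ^ (ℤ.- + C (toℕ i)))))
  ×
  (eval 𝓢 ζ ≈
    ζ^ (+ C k ℤ.- + (2 ℕ.* k) ℤ.- ℤ.1ℤ) * (∑[ i < k ] ((- 1#) ^ suc (toℕ i) * ζ^ (ℤ.- + C (suc (toℕ i))))))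
theorem1p5 ζ ζ-primitive r s _ _ expansion =
    eval-upper c {𝓡} (proj₂ (upper-entry c 2≤c)) (λ j → ℂᵣ.refl {term c (2 ℕ.+ toℕ j)})
  , eval-lower c {𝓢} (proj₂ (lower-entry c 2≤c)) (λ j → ℂᵣ.refl {term c (2 ℕ.+ toℕ j)})
  where
  open HJExpansion expansion using (c; 2≤c; 𝓡; 𝓢)
  -- The inverse of ζ supplied by `root-isUnit` is ζ⁵, and σ becomes the very `- 1#` of the
  -- statement.
  open Evaluation.LaurentValues.SixthRoot ℂ-commutativeRing ζ (root-isUnit ζ-primitive)
    (primitiveSixthRoot⇒ζ²+1≈ζ ℂ-commutativeRing ℂ-noZeroDivisors {ζ} ζ-primitive)
    (- 1#) (ℂᵣ.refl { - 1# })
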